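{- For any regular calculus $(T,P)$, $P\colon\mathbb F\mathsf{Rg}(T)\to\mathbb P\mathrm{oset}$, the category $\mathcal R_P:=\mathrm{LAdj}(\mathbb I\mathrm{ntRel}_P)$ of internal functions in $\mathbb I\mathrm{ntRel}_P$ is a regular category.
   Context: Composition is written in diagrammatic order, $f\,;g$. A po-category is a category enriched in posets; po-functors are enriched functors; $\mathbb P\mathrm{oset}$ is the symmetric monoidal po-category of posets and monotone maps (ordered pointwise) with cartesian product. In a po-category, $f\colon a\to b$ is left adjoint to $g\colon b\to a$ if $\mathrm{id}_a\le f\,;g$ and $g\,;f\le\mathrm{id}_b$; $\mathrm{LAdj}(\mathscr C)$ is the category with the objects of $\mathscr C$ and with the left adjoints of $\mathscr C$ as morphisms. A po-functor between symmetric monoidal po-categories is ajax if it is lax symmetric monoidal and all its laxators are right adjoints. A regular category is a category with finite limits, coequalizers of kernel pairs, and pullback-stable regular epimorphisms. For a regular category $\mathcal R$, $\mathbb R\mathrm{el}_{\mathcal R}$ is the po-category with the objects of $\mathcal R$, morphisms $r\to s$ the subobjects of $r\times s$ ordered by inclusion, composition by pullback followed by image; it is symmetric monoidal via $\times$. For a set $T$, $\mathsf{FRg}(T)$ is the regular category with objects $\Gamma=(n,S,\tau)$, $n\in\mathbb N$, $S\subseteq T$ finite, $\tau\colon\underline n=\{1,\dots,n\}\to S$; a morphism $(n,S,\tau)\to(n',S',\tau')$ exists only if $S'\subseteq S$, and is then a function $f\colon\underline n'\to\underline n$ with $\tau\circ f=\tau'$. Terminal object: $0=(0,\varnothing,!)$;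 product: $\Gamma\oplus\Gamma'=(n+n',S\cup S',[\tau,\tau'])$. Put $\mathbb F\mathsf{Rg}(T):=\mathbb R\mathrm{el}_{\mathsf{FRg}(T)}$. A regular calculus is a pair $(T,P)$ with $T$ a set and $P\colon\mathbb F\mathsf{Rg}(T)\to\mathbb P\mathrm{oset}$ an ajax po-functor, with laxators $\rho$. The order of $P(\Gamma)$ is written $\vdash$. For $f\colon\Gamma\to\Gamma'$ in $\mathsf{FRg}(T)$, $f_!\colon P(\Gamma)\to P(\Gamma')$ and $f^*\colon P(\Gamma')\to P(\Gamma)$ are $P$ applied to the graph $\langle\mathrm{id},f\rangle\subseteq\Gamma\oplus\Gamma'$ and the cograph $\langle f,\mathrm{id}\rangle\subseteq\Gamma'\oplus\Gamma$ of $f$; $f_!$ is left adjoint to $f^*$. Let $\pi_i$ denote projections and $\delta_\Gamma\colon\Gamma\to\Gamma\oplus\Gamma$ diagonals. The po-category $\mathbb I\mathrm{ntRel}_P$ of internal relations: objects are pairs $(\Gamma,\varphi)$ with $\varphi\in P(\Gamma)$; the hom-poset from $(\Gamma_1,\varphi_1)$ to $(\Gamma_2,\varphi_2)$ is $\{\theta\in P(\Gamma_1\oplus\Gamma_2)\mid(\pi_1)_!\theta\vdash\varphi_1,\ (\pi_2)_!\theta\vdash\varphi_2\}$ with the order of $P(\Gamma_1\oplus\Gamma_2)$; the composite of $\theta\in P(\Gamma_1\oplus\Gamma_2)$ and $\theta'\in P(\Gamma_2\oplus\Gamma_3)$ is $\theta\,;\theta':=(\pi_{13})_!\,(\Gamma_1\oplus\delta_{\Gamma_2}\oplus\Gamma_3)^*\,\rho(\theta,\theta')$,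 where $\pi_{13}\colon\Gamma_1\oplus\Gamma_2\oplus\Gamma_3\to\Gamma_1\oplus\Gamma_3$; the identity on $(\Gamma,\varphi)$ is $\mathrm{id}_\varphi:=(\delta_\Gamma)_!(\varphi)$. Morphisms of $\mathcal R_P$ are called internal functions. -}

module Defs where

open import Data.Product
  using (Σ; Σ-syntax; ∃; _,_; proj₁; proj₂) renaming (_×_ to _∧_)
import Data.Product as Prod
open import Data.Product.Relation.Binary.Pointwise.NonDependent using (×-poset)
open import Data.Unit.Polymorphic using (tt) renaming (⊤ to 𝟙)
open import Level using (Level; _⊔_; suc; lift; lower)
open import Relation.Binary using (IsEquivalence; Poset; Setoid)
import Relation.Binary.Construct.On as On
open import Relation.Binary.Morphism.Bundles using (PosetHomomorphism; mkPosetHomo)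
import Relation.Binary.Morphism.Construct.Composition as Composition
import Relation.Binary.Morphism.Construct.Identity as Identity
import Relation.Binary.Reasoning.Setoid as SetoidReasoning

record Category o ℓ e : Set (suc (o ⊔ ℓ ⊔ e)) where
  infix  4 _⇒_ _≈_
  infixr 9 _⨾_
  field
    Obj : Set o
    _⇒_ : Obj → Obj → Set ℓ
    _≈_ : ∀ {A B} → A ⇒ B → A ⇒ B → Set e
    id  : ∀ {A} → A ⇒ A
    _⨾_ : ∀ {A B C} → A ⇒ B → B ⇒ C → A ⇒ C

    equiv     : ∀ {A B} → IsEquivalence (_≈_ {A} {B})
    ⨾-cong    : ∀ {A B C} {f f′ : A ⇒ B} {g g′ : B ⇒ C} →
                f ≈ f′ → g ≈ g′ → f ⨾ g ≈ f′ ⨾ g′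
    identityˡ : ∀ {A B} {f : A ⇒ B} → id ⨾ f ≈ f
    identityʳ : ∀ {A B} {f : A ⇒ B} → f ⨾ id ≈ f
    assoc     : ∀ {A B C D} {f : A ⇒ B} {g : B ⇒ C} {h : C ⇒ D} →
                (f ⨾ g) ⨾ h ≈ f ⨾ (g ⨾ h)

  module Equiv {A B} = IsEquivalence (equiv {A} {B})

  hom-setoid : Obj → Obj → Setoid ℓ e
  hom-setoid A B = record { isEquivalence = equiv {A} {B} }

  module HomReasoning {A B} = SetoidReasoning (hom-setoid A B)

module _ {o ℓ e} (𝒞 : Category o ℓ e) where
  open Category 𝒞

  Mono : ∀ {A B} → A ⇒ B → Set (o ⊔ ℓ ⊔ e)
  Mono {A} m = ∀ {X} {u v : X ⇒ A} → u ⨾ m ≈ v ⨾ m → u ≈ v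

  record Terminal : Set (o ⊔ ℓ ⊔ e) where
    field
      ⊤        : Obj
      !        : ∀ {X} → X ⇒ ⊤
      !-unique : ∀ {X} {f g : X ⇒ ⊤} → f ≈ g

  record Product (A B : Obj) : Set (o ⊔ ℓ ⊔ e) where
    field
      A×B      : Obj
      π₁       : A×B ⇒ A
      π₂       : A×B ⇒ B
      ⟨_,_⟩    : ∀ {X} → X ⇒ A → X ⇒ B → X ⇒ A×B
      project₁ : ∀ {X} {f : X ⇒ A} {g : X ⇒ B} → ⟨ f , g ⟩ ⨾ π₁ ≈ f
      project₂ : ∀ {X} {f : X ⇒ A} {g : X ⇒ B} → ⟨ f , g ⟩ ⨾ π₂ ≈ g
      unique   : ∀ {X} {f : X ⇒ A} {g : X ⇒ B} {h : X ⇒ A×B} →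
                 h ⨾ π₁ ≈ f → h ⨾ π₂ ≈ g → h ≈ ⟨ f , g ⟩

  record Equalizer {A B} (f g : A ⇒ B) : Set (o ⊔ ℓ ⊔ e) where
    field
      E         : Obj
      eq        : E ⇒ A
      equality  : eq ⨾ f ≈ eq ⨾ g
      universal : ∀ {X} {h : X ⇒ A} → h ⨾ f ≈ h ⨾ g → X ⇒ E
      factors   : ∀ {X} {h : X ⇒ A} (p : h ⨾ f ≈ h ⨾ g) → universal p ⨾ eq ≈ h
      unique    : ∀ {X} {h : X ⇒ A} {p : h ⨾ f ≈ h ⨾ g} {k : X ⇒ E} →
                  k ⨾ eq ≈ h → k ≈ universal p

  record IsPullback {A B C P} (f : A ⇒ C) (g : B ⇒ C) (p : P ⇒ A) (q : P ⇒ B)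
                    : Set (o ⊔ ℓ ⊔ e) where
    field
      commute   : p ⨾ f ≈ q ⨾ g
      universal : ∀ {X} {x : X ⇒ A} {y : X ⇒ B} → x ⨾ f ≈ y ⨾ g → X ⇒ P
      factors₁  : ∀ {X} {x : X ⇒ A} {y : X ⇒ B} (s : x ⨾ f ≈ y ⨾ g) → universal s ⨾ p ≈ x
      factors₂  : ∀ {X} {x : X ⇒ A} {y : X ⇒ B} (s : x ⨾ f ≈ y ⨾ g) → universal s ⨾ q ≈ y
      unique    : ∀ {X} {x : X ⇒ A} {y : X ⇒ B} {s : x ⨾ f ≈ y ⨾ g} {k : X ⇒ P} →
                  k ⨾ p ≈ x → k ⨾ q ≈ y → k ≈ universal s

  record IsCoequalizer {A B Q} (f g : A ⇒ B) (q : B ⇒ Q) : Set (o ⊔ ℓ ⊔ e) where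
    field
      equality  : f ⨾ q ≈ g ⨾ q
      universal : ∀ {X} {h : B ⇒ X} → f ⨾ h ≈ g ⨾ h → Q ⇒ X
      factors   : ∀ {X} {h : B ⇒ X} (p : f ⨾ h ≈ g ⨾ h) → q ⨾ universal p ≈ h
      unique    : ∀ {X} {h : B ⇒ X} {p : f ⨾ h ≈ g ⨾ h} {k : Q ⇒ X} →
                  q ⨾ k ≈ h → k ≈ universal p

  record Coequalizer {A B} (f g : A ⇒ B) : Set (o ⊔ ℓ ⊔ e) where
    field
      Q             : Obj
      coeq          : B ⇒ Q
      isCoequalizer : IsCoequalizer f g coeq

  record RegularEpi {B Q} (q : B ⇒ Q) : Set (o ⊔ ℓ ⊔ e) where
    field
      {A}           : Obj
      f g           : A ⇒ B
      isCoequalizer : IsCoequalizer f g q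

  record FiniteLimits : Set (o ⊔ ℓ ⊔ e) where
    field
      terminal  : Terminal
      product   : ∀ A B → Product A B
      equalizer : ∀ {A B} (f g : A ⇒ B) → Equalizer f g

  record IsRegular : Set (o ⊔ ℓ ⊔ e) where
    field
      finiteLimits      : FiniteLimits
      kernelCoequalizer : ∀ {A B K} {f : A ⇒ B} {p q : K ⇒ A} →
                          IsPullback f f p q → Coequalizer p q
      stable            : ∀ {A B C P} {f : A ⇒ C} {g : B ⇒ C} {p : P ⇒ A} {q : P ⇒ B} →
                          IsPullback f g p q → RegularEpi g → RegularEpi p

record RegularCategory o ℓ e : Set (suc (o ⊔ ℓ ⊔ e)) where
  field
    category  : Category o ℓ e
    isRegular : IsRegular category

  open Category category public
  open IsRegular isRegular public

module RegularTools {o ℓ e} (ℛ : RegularCategory o ℓ e) where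
  open RegularCategory ℛ
  open FiniteLimits finiteLimits public
  open Terminal terminal public
  open Equiv
  open HomReasoning

  infixr 7 _×_ _×₁_

  _×_ : Obj → Obj → Obj
  A × B = Product.A×B (product A B)

  module _ {A B : Obj} where
    open Product (product A B) public
      using (π₁; π₂; ⟨_,_⟩; project₁; project₂) renaming (unique to ⟨⟩-unique)

  _×₁_ : ∀ {A B C D} → A ⇒ C → B ⇒ D → A × B ⇒ C × D
  f ×₁ g = ⟨ π₁ ⨾ f , π₂ ⨾ g ⟩

  δ : ∀ {A} → A ⇒ A × A
  δ = ⟨ id , id ⟩

  sym-assoc : ∀ {A B C D} {f : A ⇒ B} {g : B ⇒ C} {h : C ⇒ D} →
              f ⨾ (g ⨾ h) ≈ (f ⨾ g) ⨾ h
  sym-assoc = sym assoc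

  ⨾-congˡ : ∀ {A B C} {f : A ⇒ B} {g g′ : B ⇒ C} → g ≈ g′ → f ⨾ g ≈ f ⨾ g′
  ⨾-congˡ = ⨾-cong refl

  ⨾-congʳ : ∀ {A B C} {f f′ : A ⇒ B} {g : B ⇒ C} → f ≈ f′ → f ⨾ g ≈ f′ ⨾ g
  ⨾-congʳ p = ⨾-cong p refl

  pullˡ : ∀ {A B C D} {f : A ⇒ B} {g : B ⇒ C} {h : C ⇒ D} {k : A ⇒ C} →
          f ⨾ g ≈ k → f ⨾ g ⨾ h ≈ k ⨾ h
  pullˡ p = trans sym-assoc (⨾-congʳ p)

  pullʳ : ∀ {A B C D} {f : A ⇒ B} {g : B ⇒ C} {h : C ⇒ D} {k : B ⇒ D} →
          g ⨾ h ≈ k → (f ⨾ g) ⨾ h ≈ f ⨾ k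
  pullʳ p = trans assoc (⨾-congˡ p)

  ⟨⟩-cong : ∀ {A B X} {f f′ : X ⇒ A} {g g′ : X ⇒ B} →
            f ≈ f′ → g ≈ g′ → ⟨ f , g ⟩ ≈ ⟨ f′ , g′ ⟩
  ⟨⟩-cong p q = ⟨⟩-unique (trans project₁ p) (trans project₂ q)

  ext : ∀ {A B X} {h k : X ⇒ A × B} → h ⨾ π₁ ≈ k ⨾ π₁ → h ⨾ π₂ ≈ k ⨾ π₂ → h ≈ k
  ext p q = trans (⟨⟩-unique p q) (sym (⟨⟩-unique refl refl))

  ⨾⟨⟩ : ∀ {A B X Y} {h : Y ⇒ X} {f : X ⇒ A} {g : X ⇒ B} →
        h ⨾ ⟨ f , g ⟩ ≈ ⟨ h ⨾ f , h ⨾ g ⟩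
  ⨾⟨⟩ = ⟨⟩-unique (pullʳ project₁) (pullʳ project₂)

  η : ∀ {A B X} {h : X ⇒ A × B} → h ≈ ⟨ h ⨾ π₁ , h ⨾ π₂ ⟩
  η = ⟨⟩-unique refl refl

  ⟨⟩×₁ : ∀ {A B C D X} {x : X ⇒ A} {y : X ⇒ B} {f : A ⇒ C} {g : B ⇒ D} →
         ⟨ x , y ⟩ ⨾ (f ×₁ g) ≈ ⟨ x ⨾ f , y ⨾ g ⟩
  ⟨⟩×₁ = trans ⨾⟨⟩ (⟨⟩-cong (pullˡ project₁) (pullˡ project₂))

  ⨾δ : ∀ {A X} {x : X ⇒ A} → x ⨾ δ ≈ ⟨ x , x ⟩
  ⨾δ = trans ⨾⟨⟩ (⟨⟩-cong identityʳ identityʳ)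

  record Pullback {A B C} (f : A ⇒ C) (g : B ⇒ C) : Set (o ⊔ ℓ ⊔ e) where
    field
      {P}        : Obj
      p₁         : P ⇒ A
      p₂         : P ⇒ B
      isPullback : IsPullback category f g p₁ p₂
    open IsPullback isPullback public

    jointly-monic : ∀ {X} {u v : X ⇒ P} → u ⨾ p₁ ≈ v ⨾ p₁ → u ⨾ p₂ ≈ v ⨾ p₂ → u ≈ v
    jointly-monic r s = trans (unique {s = t} r s) (sym (unique refl refl))
      where t = trans assoc (trans (⨾-congˡ commute) sym-assoc)

  pullback : ∀ {A B C} (f : A ⇒ C) (g : B ⇒ C) → Pullback f g
  pullback f g = record
    { p₁ = eq ⨾ π₁
    ; p₂ = eq ⨾ π₂
    ; isPullback = record
      { commute   = trans assoc (trans equality sym-assoc)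
      ; universal = λ s → universal (lem s)
      ; factors₁  = λ s → trans (pullˡ (factors (lem s))) project₁
      ; factors₂  = λ s → trans (pullˡ (factors (lem s))) project₂
      ; unique    = λ {_} {_} {_} {s} p q →
          unique {p = lem s} (⟨⟩-unique (trans assoc p) (trans assoc q))
      }
    }
    where
    open Equalizer (equalizer (π₁ ⨾ f) (π₂ ⨾ g))
    lem : ∀ {X} {x : X ⇒ _} {y : X ⇒ _} → x ⨾ f ≈ y ⨾ g →
          ⟨ x , y ⟩ ⨾ π₁ ⨾ f ≈ ⟨ x , y ⟩ ⨾ π₂ ⨾ g
    lem s = trans (pullˡ project₁) (trans s (sym (pullˡ project₂)))

  RegEpi : ∀ {A B} → A ⇒ B → Set _
  RegEpi = RegularEpi category

  regEpi-epi : ∀ {A B C} {q : A ⇒ B} {u v : B ⇒ C} → RegEpi q → q ⨾ u ≈ q ⨾ v → u ≈ v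
  regEpi-epi r p = trans (unique {p = t} p) (sym (unique refl))
    where
    open RegularEpi r
    open IsCoequalizer isCoequalizer
    t = trans sym-assoc (trans (⨾-congʳ equality) assoc)

  -- A regular epimorphism is left orthogonal to monomorphisms.
  descend : ∀ {A B C D} {q : A ⇒ B} {m : C ⇒ D} {x : A ⇒ C} {y : B ⇒ D} →
            RegEpi q → Mono category m → x ⨾ m ≈ q ⨾ y → Σ[ h ∈ B ⇒ C ] h ⨾ m ≈ y
  descend {q = q} {m} {x} {y} r mono s = universal t , regEpi-epi r
      (trans (pullˡ (factors t)) s)
    where
    open RegularEpi r
    open IsCoequalizer isCoequalizer
    t : f ⨾ x ≈ g ⨾ x
    t = mono (begin
      (f ⨾ x) ⨾ m  ≈⟨ pullʳ s ⟩
      f ⨾ q ⨾ y    ≈⟨ pullˡ equality ⟩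
      (g ⨾ q) ⨾ y  ≈⟨ pullʳ (sym s) ⟩
      g ⨾ x ⨾ m    ≈⟨ sym-assoc ⟩
      (g ⨾ x) ⨾ m  ∎)

  record Image {A B} (f : A ⇒ B) : Set (o ⊔ ℓ ⊔ e) where
    field
      {I}     : Obj
      cover   : A ⇒ I
      incl    : I ⇒ B
      regEpi  : RegEpi cover
      mono    : Mono category incl
      factors : cover ⨾ incl ≈ f

  image : ∀ {A B} (f : A ⇒ B) → Image f
  image {A} {B} f = record
    { cover = coeq ; incl = m ; regEpi = re ; mono = mono ; factors = E.factors K.commute }
    where
    module K = Pullback (pullback f f)
    open Coequalizer (kernelCoequalizer K.isPullback)
    module E = IsCoequalizer isCoequalizer
    m = E.universal K.commute
    re : RegEpi coeq
    re = record { isCoequalizer = isCoequalizer }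
    mono : Mono category m
    mono {X} {u} {v} um≈vm =
      regEpi-epi (stable U.isPullback re) (regEpi-epi (stable V.isPullback re) (begin
        V.p₁ ⨾ U.p₁ ⨾ u                ≈⟨ ⨾-congˡ U.commute ⟩
        V.p₁ ⨾ U.p₂ ⨾ coeq             ≈⟨ sym-assoc ⟩
        (V.p₁ ⨾ U.p₂) ⨾ coeq           ≈⟨ ⨾-congʳ (K.factors₁ s) ⟨
        (K.universal s ⨾ K.p₁) ⨾ coeq  ≈⟨ pullʳ E.equality ⟩
        K.universal s ⨾ K.p₂ ⨾ coeq    ≈⟨ pullˡ (K.factors₂ s) ⟩
        V.p₂ ⨾ coeq                    ≈⟨ V.commute ⟨
        V.p₁ ⨾ U.p₁ ⨾ v                ∎))
      where
      module U = Pullback (pullback u coeq)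
      module V = Pullback (pullback (U.p₁ ⨾ v) coeq)
      em : coeq ⨾ m ≈ f
      em = E.factors K.commute
      s : (V.p₁ ⨾ U.p₂) ⨾ f ≈ V.p₂ ⨾ f
      s = begin
        (V.p₁ ⨾ U.p₂) ⨾ f          ≈⟨ pullʳ (⨾-congˡ (sym em)) ⟩
        V.p₁ ⨾ U.p₂ ⨾ coeq ⨾ m     ≈⟨ ⨾-congˡ (pullˡ (sym U.commute)) ⟩
        V.p₁ ⨾ (U.p₁ ⨾ u) ⨾ m      ≈⟨ ⨾-congˡ (pullʳ um≈vm) ⟩
        V.p₁ ⨾ U.p₁ ⨾ v ⨾ m        ≈⟨ ⨾-congˡ sym-assoc ⟩
        V.p₁ ⨾ (U.p₁ ⨾ v) ⨾ m      ≈⟨ pullˡ V.commute ⟩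
        (V.p₂ ⨾ coeq) ⨾ m          ≈⟨ pullʳ em ⟩
        V.p₂ ⨾ f                   ∎

record PoCategory o c ℓ₁ ℓ₂ : Set (suc (o ⊔ c ⊔ ℓ₁ ⊔ ℓ₂)) where
  infix  4 _⇒_
  infixr 9 _⨾_
  field
    Obj : Set o
    Hom : Obj → Obj → Poset c ℓ₁ ℓ₂

  module Homs {A B} = Poset (Hom A B)
  open Homs public using (_≈_; _≤_)

  _⇒_ : Obj → Obj → Set c
  A ⇒ B = Poset.Carrier (Hom A B)

  field
    id  : ∀ {A} → A ⇒ A
    _⨾_ : ∀ {A B C} → A ⇒ B → B ⇒ C → A ⇒ C

    ⨾-mono    : ∀ {A B C} {f f′ : A ⇒ B} {g g′ : B ⇒ C} →
                f ≤ f′ → g ≤ g′ → f ⨾ g ≤ f′ ⨾ g′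
    identityˡ : ∀ {A B} {f : A ⇒ B} → id ⨾ f ≈ f
    identityʳ : ∀ {A B} {f : A ⇒ B} → f ⨾ id ≈ f
    assoc     : ∀ {A B C D} {f : A ⇒ B} {g : B ⇒ C} {h : C ⇒ D} →
                (f ⨾ g) ⨾ h ≈ f ⨾ (g ⨾ h)

  ⨾-cong : ∀ {A B C} {f f′ : A ⇒ B} {g g′ : B ⇒ C} →
           f ≈ f′ → g ≈ g′ → f ⨾ g ≈ f′ ⨾ g′
  ⨾-cong p q = Homs.antisym
    (⨾-mono (Homs.reflexive p) (Homs.reflexive q))
    (⨾-mono (Homs.reflexive (Homs.Eq.sym p)) (Homs.reflexive (Homs.Eq.sym q)))

  infix 4 _⊣_
  _⊣_ : ∀ {A B} → A ⇒ B → B ⇒ A → Set ℓ₂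
  f ⊣ g = (id ≤ f ⨾ g) ∧ (g ⨾ f ≤ id)

  IsRightAdjoint : ∀ {A B} → B ⇒ A → Set (c ⊔ ℓ₂)
  IsRightAdjoint {A} {B} g = Σ[ f ∈ A ⇒ B ] f ⊣ g

  IsLeftAdjoint : ∀ {A B} → A ⇒ B → Set (c ⊔ ℓ₂)
  IsLeftAdjoint {A} {B} f = Σ[ g ∈ B ⇒ A ] f ⊣ g

-- Right adjoints are unique up to _≈_, so a morphism of LAdj carries one and
-- equality of morphisms compares the left adjoints only.
LAdj : ∀ {o c ℓ₁ ℓ₂} → PoCategory o c ℓ₁ ℓ₂ → Category o (c ⊔ ℓ₂) ℓ₁
LAdj 𝒞 = record
  { Obj       = Obj
  ; _⇒_       = λ A B → Σ (A ⇒ B) IsLeftAdjoint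
  ; _≈_       = λ f g → proj₁ f ≈ proj₁ g
  ; id        = id , id , Homs.reflexive (Homs.Eq.sym identityˡ) , Homs.reflexive identityˡ
  ; _⨾_       = λ (f , f* , η , ε) (g , g* , η′ , ε′) → f ⨾ g , g* ⨾ f* ,
                  Homs.trans η (Homs.trans (insert η′) (Homs.reflexive regroup)) ,
                  Homs.trans (Homs.reflexive (Homs.Eq.sym regroup)) (Homs.trans (delete ε) ε′)
  ; equiv     = record { refl = Homs.Eq.refl ; sym = Homs.Eq.sym ; trans = Homs.Eq.trans }
  ; ⨾-cong    = ⨾-cong
  ; identityˡ = identityˡ
  ; identityʳ = identityʳ
  ; assoc     = assoc
  }
  where
  open PoCategory 𝒞
  regroup : ∀ {A B C D E} {f : A ⇒ B} {g : B ⇒ C} {h : C ⇒ D} {k : D ⇒ E} →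
              f ⨾ ((g ⨾ h) ⨾ k) ≈ (f ⨾ g) ⨾ (h ⨾ k)
  regroup = Homs.Eq.trans (⨾-cong Homs.Eq.refl assoc) (Homs.Eq.sym assoc)
  insert : ∀ {A B C} {f : A ⇒ B} {h : B ⇒ B} {k : B ⇒ C} → id ≤ h → f ⨾ k ≤ f ⨾ (h ⨾ k)
  insert p = ⨾-mono Homs.refl
    (Homs.trans (Homs.reflexive (Homs.Eq.sym identityˡ)) (⨾-mono p Homs.refl))
  delete : ∀ {A B C} {f : A ⇒ B} {h : B ⇒ B} {k : B ⇒ C} → h ≤ id → f ⨾ (h ⨾ k) ≤ f ⨾ k
  delete p = ⨾-mono Homs.refl
    (Homs.trans (⨾-mono p Homs.refl) (Homs.reflexive identityˡ))

record Symmetric {o c ℓ₁ ℓ₂} (𝒞 : PoCategory o c ℓ₁ ℓ₂) : Set (o ⊔ c ⊔ ℓ₁ ⊔ ℓ₂) where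
  open PoCategory 𝒞
  infixr 10 _⊗₀_ _⊗₁_
  field
    unit : Obj
    _⊗₀_ : Obj → Obj → Obj
    _⊗₁_ : ∀ {A B C D} → A ⇒ C → B ⇒ D → A ⊗₀ B ⇒ C ⊗₀ D

    ⊗-mono : ∀ {A B C D} {f f′ : A ⇒ C} {g g′ : B ⇒ D} →
             f ≤ f′ → g ≤ g′ → f ⊗₁ g ≤ f′ ⊗₁ g′
    ⊗-id   : ∀ {A B} → id {A} ⊗₁ id {B} ≈ id
    ⊗-⨾    : ∀ {A B C A′ B′ C′} {f : A ⇒ B} {g : B ⇒ C} {f′ : A′ ⇒ B′} {g′ : B′ ⇒ C′} →
             (f ⨾ g) ⊗₁ (f′ ⨾ g′) ≈ (f ⊗₁ f′) ⨾ (g ⊗₁ g′)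

    α   : ∀ {A B C} → (A ⊗₀ B) ⊗₀ C ⇒ A ⊗₀ (B ⊗₀ C)
    α⁻¹ : ∀ {A B C} → A ⊗₀ (B ⊗₀ C) ⇒ (A ⊗₀ B) ⊗₀ C
    l   : ∀ {A} → unit ⊗₀ A ⇒ A
    l⁻¹ : ∀ {A} → A ⇒ unit ⊗₀ A
    r   : ∀ {A} → A ⊗₀ unit ⇒ A
    r⁻¹ : ∀ {A} → A ⇒ A ⊗₀ unit
    σ   : ∀ {A B} → A ⊗₀ B ⇒ B ⊗₀ A

    α-isoˡ : ∀ {A B C} → α {A} {B} {C} ⨾ α⁻¹ ≈ id
    α-isoʳ : ∀ {A B C} → α⁻¹ {A} {B} {C} ⨾ α ≈ id
    l-isoˡ : ∀ {A} → l {A} ⨾ l⁻¹ ≈ id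
    l-isoʳ : ∀ {A} → l⁻¹ {A} ⨾ l ≈ id
    r-isoˡ : ∀ {A} → r {A} ⨾ r⁻¹ ≈ id
    r-isoʳ : ∀ {A} → r⁻¹ {A} ⨾ r ≈ id
    σ-inv  : ∀ {A B} → σ {A} {B} ⨾ σ ≈ id

    α-natural : ∀ {A B C A′ B′ C′} {f : A ⇒ A′} {g : B ⇒ B′} {h : C ⇒ C′} →
                ((f ⊗₁ g) ⊗₁ h) ⨾ α ≈ α ⨾ (f ⊗₁ (g ⊗₁ h))
    l-natural : ∀ {A A′} {f : A ⇒ A′} → (id ⊗₁ f) ⨾ l ≈ l ⨾ f
    r-natural : ∀ {A A′} {f : A ⇒ A′} → (f ⊗₁ id) ⨾ r ≈ r ⨾ f
    σ-natural : ∀ {A B A′ B′} {f : A ⇒ A′} {g : B ⇒ B′} →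
                (f ⊗₁ g) ⨾ σ ≈ σ ⨾ (g ⊗₁ f)

    pentagon : ∀ {A B C D} →
               (α {A} {B} {C} ⊗₁ id {D}) ⨾ α ⨾ (id ⊗₁ α) ≈ α ⨾ α
    triangle : ∀ {A B} → α {A} {unit} {B} ⨾ (id ⊗₁ l) ≈ r ⊗₁ id
    hexagon  : ∀ {A B C} →
               α {A} {B} {C} ⨾ σ ⨾ α ≈ (σ ⊗₁ id) ⨾ α ⨾ (id ⊗₁ σ)

record SymmetricMonoidalPoCategory o c ℓ₁ ℓ₂ : Set (suc (o ⊔ c ⊔ ℓ₁ ⊔ ℓ₂)) where
  field
    poCategory : PoCategory o c ℓ₁ ℓ₂
    symmetric  : Symmetric poCategory
  open PoCategory poCategory public
  open Symmetric symmetric public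

record PoFunctor {o c ℓ₁ ℓ₂ o′ c′ ℓ₁′ ℓ₂′}
                 (𝒞 : PoCategory o c ℓ₁ ℓ₂) (𝒟 : PoCategory o′ c′ ℓ₁′ ℓ₂′)
                 : Set (o ⊔ c ⊔ ℓ₁ ⊔ ℓ₂ ⊔ o′ ⊔ c′ ⊔ ℓ₁′ ⊔ ℓ₂′) where
  private
    module C = PoCategory 𝒞
    module D = PoCategory 𝒟
  field
    F₀     : C.Obj → D.Obj
    F₁     : ∀ {A B} → A C.⇒ B → F₀ A D.⇒ F₀ B
    F-mono : ∀ {A B} {f g : A C.⇒ B} → f C.≤ g → F₁ f D.≤ F₁ g
    F-id   : ∀ {A} → F₁ (C.id {A}) D.≈ D.id
    F-⨾    : ∀ {A B C} {f : A C.⇒ B} {g : B C.⇒ C} → F₁ (f C.⨾ g) D.≈ F₁ f D.⨾ F₁ g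

  F-cong : ∀ {A B} {f g : A C.⇒ B} → f C.≈ g → F₁ f D.≈ F₁ g
  F-cong p = D.Homs.antisym (F-mono (C.Homs.reflexive p))
                            (F-mono (C.Homs.reflexive (C.Homs.Eq.sym p)))

record AjaxPoFunctor {o c ℓ₁ ℓ₂ o′ c′ ℓ₁′ ℓ₂′}
                     (𝒞 : SymmetricMonoidalPoCategory o c ℓ₁ ℓ₂)
                     (𝒟 : SymmetricMonoidalPoCategory o′ c′ ℓ₁′ ℓ₂′)
                     : Set (o ⊔ c ⊔ ℓ₁ ⊔ ℓ₂ ⊔ o′ ⊔ c′ ⊔ ℓ₁′ ⊔ ℓ₂′) where
  private
    module C = SymmetricMonoidalPoCategory 𝒞
    module D = SymmetricMonoidalPoCategory 𝒟
  field
    poFunctor : PoFunctor C.poCategory D.poCategory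
  open PoFunctor poFunctor public
  field
    ρ₀ : D.unit D.⇒ F₀ C.unit
    ρ  : ∀ {A B} → F₀ A D.⊗₀ F₀ B D.⇒ F₀ (A C.⊗₀ B)

    ρ-natural : ∀ {A B A′ B′} {f : A C.⇒ A′} {g : B C.⇒ B′} →
                (F₁ f D.⊗₁ F₁ g) D.⨾ ρ D.≈ ρ D.⨾ F₁ (f C.⊗₁ g)
    ρ-assoc   : ∀ {A B C} →
                (ρ {A} {B} D.⊗₁ D.id {F₀ C}) D.⨾ ρ D.⨾ F₁ C.α D.≈
                D.α D.⨾ (D.id D.⊗₁ ρ) D.⨾ ρ
    ρ-unitˡ   : ∀ {A} → (ρ₀ D.⊗₁ D.id {F₀ A}) D.⨾ ρ D.⨾ F₁ C.l D.≈ D.l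
    ρ-unitʳ   : ∀ {A} → (D.id {F₀ A} D.⊗₁ ρ₀) D.⨾ ρ D.⨾ F₁ C.r D.≈ D.r
    ρ-sym     : ∀ {A B} → ρ {A} {B} D.⨾ F₁ C.σ D.≈ D.σ D.⨾ ρ

    ρ₀-rightAdjoint : D.IsRightAdjoint ρ₀
    ρ-rightAdjoint  : ∀ {A B} → D.IsRightAdjoint (ρ {A} {B})

module _ (c ℓ₁ ℓ₂ : Level) where
  private
    homPoset : Poset c ℓ₁ ℓ₂ → Poset c ℓ₁ ℓ₂ → Poset (c ⊔ ℓ₁ ⊔ ℓ₂) (c ⊔ ℓ₁) (c ⊔ ℓ₂)
    homPoset P Q = record
      { Carrier = PosetHomomorphism P Q
      ; _≈_ = λ f g → ∀ x → ⟦ f ⟧ x Q.≈ ⟦ g ⟧ x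
      ; _≤_ = λ f g → ∀ x → ⟦ f ⟧ x Q.≤ ⟦ g ⟧ x
      ; isPartialOrder = record
        { isPreorder = record
          { isEquivalence = record
            { refl  = λ x → Q.Eq.refl
            ; sym   = λ p x → Q.Eq.sym (p x)
            ; trans = λ p q x → Q.Eq.trans (p x) (q x)
            }
          ; reflexive = λ p x → Q.reflexive (p x)
          ; trans     = λ p q x → Q.trans (p x) (q x)
          }
        ; antisym = λ p q x → Q.antisym (p x) (q x)
        }
      }
      where
      module Q = Poset Q
      open PosetHomomorphism using (⟦_⟧)

    unitPoset : Poset c ℓ₁ ℓ₂
    unitPoset = record
      { Carrier = 𝟙 ; _≈_ = λ _ _ → 𝟙 ; _≤_ = λ _ _ → 𝟙 ; isPartialOrder = _ }

  open PosetHomomorphism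

  POSET : SymmetricMonoidalPoCategory (suc (c ⊔ ℓ₁ ⊔ ℓ₂)) (c ⊔ ℓ₁ ⊔ ℓ₂) (c ⊔ ℓ₁) (c ⊔ ℓ₂)
  POSET = record
    { poCategory = record
      { Obj       = Poset c ℓ₁ ℓ₂
      ; Hom       = homPoset
      ; id        = λ {P} → Identity.posetHomomorphism P
      ; _⨾_       = Composition.posetHomomorphism
      ; ⨾-mono    = λ {_} {_} {R} {_} {f′} {g} p q x →
                      Poset.trans R (mono g (p x)) (q (⟦ f′ ⟧ x))
      ; identityˡ = λ {_} {Q} x → Poset.Eq.refl Q
      ; identityʳ = λ {_} {Q} x → Poset.Eq.refl Q
      ; assoc     = λ {_} {_} {_} {S} x → Poset.Eq.refl S
      }
    ; symmetric = record
      { unit = unitPoset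
      ; _⊗₀_ = ×-poset
      ; _⊗₁_ = λ f g → mkPosetHomo _ _
                 (Prod.map ⟦ f ⟧ ⟦ g ⟧) (Prod.map (mono f) (mono g))
      ; ⊗-mono = λ p q (x , y) → p x , q y
      ; ⊗-id = λ {P} {Q} x → Poset.Eq.refl (×-poset P Q)
      ; ⊗-⨾ = λ {_} {_} {R} {_} {_} {R′} x → Poset.Eq.refl (×-poset R R′)
      ; α   = mkPosetHomo _ _ Prod.assocʳ Prod.assocʳ
      ; α⁻¹ = mkPosetHomo _ _ Prod.assocˡ Prod.assocˡ
      ; l   = mkPosetHomo _ _ proj₂ proj₂
      ; l⁻¹ = mkPosetHomo _ _ (tt ,_) (tt ,_)
      ; r   = mkPosetHomo _ _ proj₁ proj₁
      ; r⁻¹ = mkPosetHomo _ _ (_, tt) (_, tt)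
      ; σ   = mkPosetHomo _ _ Prod.swap Prod.swap
      ; α-isoˡ = λ {P} {Q} {R} x → Poset.Eq.refl (×-poset (×-poset P Q) R)
      ; α-isoʳ = λ {P} {Q} {R} x → Poset.Eq.refl (×-poset P (×-poset Q R))
      ; l-isoˡ = λ {P} x → Poset.Eq.refl (×-poset unitPoset P)
      ; l-isoʳ = λ {P} x → Poset.Eq.refl P
      ; r-isoˡ = λ {P} x → Poset.Eq.refl (×-poset P unitPoset)
      ; r-isoʳ = λ {P} x → Poset.Eq.refl P
      ; σ-inv  = λ {P} {Q} x → Poset.Eq.refl (×-poset P Q)
      ; α-natural = λ {_} {_} {_} {P} {Q} {R} x → Poset.Eq.refl (×-poset P (×-poset Q R))
      ; l-natural = λ {_} {P} x → Poset.Eq.refl P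
      ; r-natural = λ {_} {P} x → Poset.Eq.refl P
      ; σ-natural = λ {_} {_} {P} {Q} x → Poset.Eq.refl (×-poset Q P)
      ; pentagon  = λ {P} {Q} {R} {S} x →
                      Poset.Eq.refl (×-poset P (×-poset Q (×-poset R S)))
      ; triangle  = λ {P} {Q} x → Poset.Eq.refl (×-poset P Q)
      ; hexagon   = λ {P} {Q} {R} x → Poset.Eq.refl (×-poset Q (×-poset R P))
      }
    }

module Relations {o ℓ e} (ℛ : RegularCategory o ℓ e) where
  open RegularCategory ℛ
  open RegularTools ℛ
  open Equiv
  open HomReasoning

  record Subobject (X : Obj) : Set (o ⊔ ℓ ⊔ e) where
    field
      {dom} : Obj
      incl  : dom ⇒ X
      mono  : Mono category incl

  open Subobject

  infix 4 _∈_ _⊆_ _≋_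

  -- Generalised elements x of X lying in a subobject.
  record _∈_ {X Δ} (x : Δ ⇒ X) (R : Subobject X) : Set (ℓ ⊔ e) where
    constructor _,_
    field
      factor  : Δ ⇒ dom R
      factors : factor ⨾ incl R ≈ x

  record _⊆_ {X} (R S : Subobject X) : Set (ℓ ⊔ e) where
    constructor _,_
    field
      factor  : dom R ⇒ dom S
      factors : factor ⨾ incl S ≈ incl R

  ∈⇒⊆ : ∀ {X} {R S : Subobject X} → incl R ∈ S → R ⊆ S
  ∈⇒⊆ (h , p) = h , p

  ∈-resp : ∀ {X Δ} {x y : Δ ⇒ X} {R : Subobject X} → x ≈ y → x ∈ R → y ∈ R
  ∈-resp p (h , q) = h , trans q p

  ∈-⊆ : ∀ {X Δ} {x : Δ ⇒ X} {R S : Subobject X} → R ⊆ S → x ∈ R → x ∈ S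
  ∈-⊆ (k , p) (h , q) = h ⨾ k , trans (pullʳ p) q

  ∈-reindex : ∀ {X Δ Δ′} {x : Δ ⇒ X} {R : Subobject X} (f : Δ′ ⇒ Δ) → x ∈ R → f ⨾ x ∈ R
  ∈-reindex f (h , q) = f ⨾ h , pullʳ q

  ∈-descend : ∀ {X Δ Δ′} {x : Δ ⇒ X} (R : Subobject X) {q : Δ′ ⇒ Δ} →
              RegEpi q → q ⨾ x ∈ R → x ∈ R
  ∈-descend R r (h , p) = let k , s = descend r (mono R) p in k , s

  _≋_ : ∀ {X} → Subobject X → Subobject X → Set (ℓ ⊔ e)
  R ≋ S = R ⊆ S ∧ S ⊆ R

  ⊆-refl : ∀ {X} {R : Subobject X} → R ⊆ R
  ⊆-refl = id , identityˡ

  ⊆-trans : ∀ {X} {R S T : Subobject X} → R ⊆ S → S ⊆ T → R ⊆ T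
  ⊆-trans (h , p) (k , q) = h ⨾ k , trans (pullʳ q) p

  ≋-refl : ∀ {X} {R : Subobject X} → R ≋ R
  ≋-refl = ⊆-refl , ⊆-refl

  ≋-sym : ∀ {X} {R S : Subobject X} → R ≋ S → S ≋ R
  ≋-sym (p , q) = q , p

  ≋-trans : ∀ {X} {R S T : Subobject X} → R ≋ S → S ≋ T → R ≋ T
  ≋-trans (p , q) (p′ , q′) = ⊆-trans p p′ , ⊆-trans q′ q

  subobjects : Obj → Poset (o ⊔ ℓ ⊔ e) (ℓ ⊔ e) (ℓ ⊔ e)
  subobjects X = record
    { Carrier = Subobject X
    ; _≈_     = _≋_
    ; _≤_     = _⊆_
    ; isPartialOrder = record
      { isPreorder = record
        { isEquivalence = record { refl = ≋-refl ; sym = ≋-sym ; trans = ≋-trans }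
        ; reflexive = proj₁
        ; trans     = ⊆-trans
        }
      ; antisym = _,_
      }
    }

  Relation : Obj → Obj → Set (o ⊔ ℓ ⊔ e)
  Relation A B = Subobject (A × B)

  infix 4 _[_]_
  _[_]_ : ∀ {A B Δ} → Δ ⇒ A → Relation A B → Δ ⇒ B → Set (ℓ ⊔ e)
  x [ R ] y = ⟨ x , y ⟩ ∈ R

  π₁[_]π₂ : ∀ {A B} (R : Relation A B) → (incl R ⨾ π₁) [ R ] (incl R ⨾ π₂)
  π₁[ R ]π₂ = id , trans identityˡ η

  ⊆-intro : ∀ {A B} {R S : Relation A B} →
            (∀ {Δ} {x : Δ ⇒ A} {y : Δ ⇒ B} → x [ R ] y → x [ S ] y) → R ⊆ S
  ⊆-intro {R = R} k = ∈⇒⊆ (∈-resp (sym η) (k π₁[ R ]π₂))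

  []-resp : ∀ {A B Δ} {x x′ : Δ ⇒ A} {y y′ : Δ ⇒ B} (R : Relation A B) →
            x ≈ x′ → y ≈ y′ → x [ R ] y → x′ [ R ] y′
  []-resp R p q = ∈-resp (⟨⟩-cong p q)

  []-reindex : ∀ {A B Δ Δ′} {x : Δ ⇒ A} {y : Δ ⇒ B} (R : Relation A B) (f : Δ′ ⇒ Δ) →
               x [ R ] y → (f ⨾ x) [ R ] (f ⨾ y)
  []-reindex R f p = ∈-resp ⨾⟨⟩ (∈-reindex f p)

  []-descend : ∀ {A B Δ Δ′} {x : Δ ⇒ A} {y : Δ ⇒ B} (R : Relation A B) {q : Δ′ ⇒ Δ} →
               RegEpi q → (q ⨾ x) [ R ] (q ⨾ y) → x [ R ] y
  []-descend R r p = ∈-descend R r (∈-resp (sym ⨾⟨⟩) p)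

  JointlyMonic : ∀ {A B D} → D ⇒ A → D ⇒ B → Set (o ⊔ ℓ ⊔ e)
  JointlyMonic {D = D} f g = ∀ {X} {u v : X ⇒ D} → u ⨾ f ≈ v ⨾ f → u ⨾ g ≈ v ⨾ g → u ≈ v

  -- The relation {(f d , g d)} for jointly monic f and g.
  span : ∀ {A B D} (f : D ⇒ A) (g : D ⇒ B) → JointlyMonic f g → Relation A B
  span f g m = record
    { incl = ⟨ f , g ⟩
    ; mono = λ p → m (trans (⨾-congˡ (sym project₁)) (trans (pullˡ p) (pullʳ project₁)))
                     (trans (⨾-congˡ (sym project₂)) (trans (pullˡ p) (pullʳ project₂)))
    }

  pair-intro : ∀ {A B D Δ} {f : D ⇒ A} {g : D ⇒ B} {h : Δ ⇒ D} {x : Δ ⇒ A} {y : Δ ⇒ B} →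
               h ⨾ f ≈ x → h ⨾ g ≈ y → h ⨾ ⟨ f , g ⟩ ≈ ⟨ x , y ⟩
  pair-intro p q = trans ⨾⟨⟩ (⟨⟩-cong p q)

  pair-elim : ∀ {A B D Δ} {f : D ⇒ A} {g : D ⇒ B} {h : Δ ⇒ D} {x : Δ ⇒ A} {y : Δ ⇒ B} →
              h ⨾ ⟨ f , g ⟩ ≈ ⟨ x , y ⟩ → h ⨾ f ≈ x ∧ h ⨾ g ≈ y
  pair-elim p = trans (⨾-congˡ (sym project₁)) (trans (pullˡ p) project₁)
              , trans (⨾-congˡ (sym project₂)) (trans (pullˡ p) project₂)

  opaque
    graph : ∀ {A B} → A ⇒ B → Relation A B
    graph f = span id f λ p _ → trans (sym identityʳ) (trans p identityʳ)

    cograph : ∀ {A B} → A ⇒ B → Relation B A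
    cograph f = span f id λ _ p → trans (sym identityʳ) (trans p identityʳ)

    graph-intro : ∀ {A B Δ} {f : A ⇒ B} {x : Δ ⇒ A} {y : Δ ⇒ B} →
                  x ⨾ f ≈ y → x [ graph f ] y
    graph-intro {x = x} p = x , pair-intro identityʳ p

    graph-elim : ∀ {A B Δ} {f : A ⇒ B} {x : Δ ⇒ A} {y : Δ ⇒ B} →
                 x [ graph f ] y → x ⨾ f ≈ y
    graph-elim (h , p) with pair-elim p
    ... | q , s = trans (⨾-congʳ (trans (sym q) identityʳ)) s

    cograph-intro : ∀ {A B Δ} {f : A ⇒ B} {x : Δ ⇒ B} {y : Δ ⇒ A} →
                    y ⨾ f ≈ x → x [ cograph f ] y
    cograph-intro {y = y} p = y , pair-intro p identityʳ

    cograph-elim : ∀ {A B Δ} {f : A ⇒ B} {x : Δ ⇒ B} {y : Δ ⇒ A} →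
                   x [ cograph f ] y → y ⨾ f ≈ x
    cograph-elim (h , p) with pair-elim p
    ... | s , q = trans (⨾-congʳ (trans (sym q) identityʳ)) s

  infixr 9 _⨟_
  opaque
    _⨟_ : ∀ {A B C} → Relation A B → Relation B C → Relation A C
    R ⨟ S = record { incl = I.incl ; mono = I.mono }
      where
      open Pullback (pullback (incl R ⨾ π₂) (incl S ⨾ π₁))
      module I = Image (image ⟨ p₁ ⨾ incl R ⨾ π₁ , p₂ ⨾ incl S ⨾ π₂ ⟩)

  module _ {A B C} (R : Relation A B) (S : Relation B C) where
    private
      module P = Pullback (pullback (incl R ⨾ π₂) (incl S ⨾ π₁))
      module I = Image (image ⟨ P.p₁ ⨾ incl R ⨾ π₁ , P.p₂ ⨾ incl S ⨾ π₂ ⟩)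
    opaque
      unfolding _⨟_

      ⨟-intro : ∀ {Δ} {x : Δ ⇒ A} {y : Δ ⇒ B} {z : Δ ⇒ C} →
                x [ R ] y → y [ S ] z → x [ R ⨟ S ] z
      ⨟-intro (h , p) (k , q) = P.universal s ⨾ I.cover , (begin
          (P.universal s ⨾ I.cover) ⨾ I.incl ≈⟨ pullʳ I.factors ⟩
          P.universal s ⨾ ⟨ P.p₁ ⨾ incl R ⨾ π₁ , P.p₂ ⨾ incl S ⨾ π₂ ⟩ ≈⟨ ⨾⟨⟩ ⟩
          ⟨ P.universal s ⨾ P.p₁ ⨾ incl R ⨾ π₁ , P.universal s ⨾ P.p₂ ⨾ incl S ⨾ π₂ ⟩
            ≈⟨ ⟨⟩-cong (trans (pullˡ (P.factors₁ s)) (trans (pullˡ p) project₁))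
                       (trans (pullˡ (P.factors₂ s)) (trans (pullˡ q) project₂)) ⟩
          ⟨ _ , _ ⟩ ∎)
        where
        s : h ⨾ incl R ⨾ π₂ ≈ k ⨾ incl S ⨾ π₁
        s = trans (pullˡ p) (trans project₂ (sym (trans (pullˡ q) project₁)))

      -- The witness in B exists only after pulling back along a cover of Δ.
      ⨟-elim : ∀ {Δ} {x : Δ ⇒ A} {z : Δ ⇒ C} → x [ R ⨟ S ] z →
               Σ[ Δ′ ∈ Obj ] Σ[ q ∈ Δ′ ⇒ Δ ] Σ[ y ∈ Δ′ ⇒ B ]
                 (RegEpi q ∧ (q ⨾ x) [ R ] y ∧ y [ S ] (q ⨾ z))
      ⨟-elim {x = x} {z} (h , p) =
        Q.P , Q.p₁ , Q.p₂ ⨾ P.p₁ ⨾ incl R ⨾ π₂ ,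
        stable Q.isPullback I.regEpi ,
        (Q.p₂ ⨾ P.p₁ , trans η (⟨⟩-cong
          (trans assoc (trans assoc (sym e₁)))
          (trans assoc assoc))) ,
        (Q.p₂ ⨾ P.p₂ , trans η (⟨⟩-cong
          (trans assoc (trans assoc (⨾-congˡ (sym P.commute))))
          (trans assoc (trans assoc (sym e₂)))))
        where
        module Q = Pullback (pullback h I.cover)
        sq : Q.p₁ ⨾ ⟨ x , z ⟩ ≈ Q.p₂ ⨾ ⟨ P.p₁ ⨾ incl R ⨾ π₁ , P.p₂ ⨾ incl S ⨾ π₂ ⟩
        sq = begin
          Q.p₁ ⨾ ⟨ x , z ⟩        ≈⟨ ⨾-congˡ p ⟨
          Q.p₁ ⨾ h ⨾ I.incl       ≈⟨ pullˡ Q.commute ⟩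
          (Q.p₂ ⨾ I.cover) ⨾ I.incl ≈⟨ pullʳ I.factors ⟩
          Q.p₂ ⨾ _ ∎
        e₁ : Q.p₁ ⨾ x ≈ Q.p₂ ⨾ P.p₁ ⨾ incl R ⨾ π₁
        e₁ = trans (⨾-congˡ (sym project₁)) (trans (pullˡ sq) (trans assoc (⨾-congˡ project₁)))
        e₂ : Q.p₁ ⨾ z ≈ Q.p₂ ⨾ P.p₂ ⨾ incl S ⨾ π₂
        e₂ = trans (⨾-congˡ (sym project₂)) (trans (pullˡ sq) (trans assoc (⨾-congˡ project₂)))

  ⨟-⊆ : ∀ {A B C} {R : Relation A B} {S : Relation B C} {T : Relation A C} →
        (∀ {Δ} {x : Δ ⇒ A} {y : Δ ⇒ B} {z : Δ ⇒ C} → x [ R ] y → y [ S ] z → x [ T ] z) →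
        R ⨟ S ⊆ T
  ⨟-⊆ {R = R} {S} {T} k = ⊆-intro λ p →
    let _ , _ , _ , r , a , b = ⨟-elim R S p in []-descend T r (k a b)

  graph-⨟ : ∀ {A B C Δ} {f : A ⇒ B} (S : Relation B C) {x : Δ ⇒ A} {z : Δ ⇒ C} →
            x [ graph f ⨟ S ] z → (x ⨾ f) [ S ] z
  graph-⨟ {f = f} S p with ⨟-elim (graph f) S p
  ... | _ , q , y , r , a , b = []-descend S r
        ([]-resp S (trans (sym (graph-elim a)) assoc) refl b)

  ⨟-cograph : ∀ {A B C Δ} {f : C ⇒ B} (R : Relation A B) {x : Δ ⇒ A} {z : Δ ⇒ C} →
              x [ R ⨟ cograph f ] z → x [ R ] (z ⨾ f)
  ⨟-cograph {f = f} R p with ⨟-elim R (cograph f) p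
  ... | _ , q , y , r , a , b = []-descend R r
        ([]-resp R refl (trans (sym (cograph-elim b)) assoc) a)

  infixr 10 _⊗_
  opaque
    _⊗_ : ∀ {A B C D} → Relation A C → Relation B D → Relation (A × B) (C × D)
    R ⊗ S = span ((incl R ⨾ π₁) ×₁ (incl S ⨾ π₁)) ((incl R ⨾ π₂) ×₁ (incl S ⨾ π₂))
      λ p q → ext
        (mono R (ext (c project₁ p) (c project₁ q)))
        (mono S (ext (c project₂ p) (c project₂ q)))
      where
      c : ∀ {U X Y Z W V} {u v : X ⇒ Y} {f : Y ⇒ W} {i : W ⇒ Z} {j : Z ⇒ V} {g : Y ⇒ U} {π : U ⇒ V} →
          g ⨾ π ≈ f ⨾ i ⨾ j → u ⨾ g ≈ v ⨾ g →
          ((u ⨾ f) ⨾ i) ⨾ j ≈ ((v ⨾ f) ⨾ i) ⨾ j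
      c s p = trans (trans assoc (pullʳ (sym s)))
                (trans (pullˡ p) (trans assoc (trans (⨾-congˡ s) (trans sym-assoc sym-assoc))))

  module _ {A B C D} (R : Relation A C) (S : Relation B D) where
    opaque
      unfolding _⊗_

      ⊗-intro : ∀ {Δ} {x : Δ ⇒ A × B} {y : Δ ⇒ C × D} →
                (x ⨾ π₁) [ R ] (y ⨾ π₁) → (x ⨾ π₂) [ S ] (y ⨾ π₂) → x [ R ⊗ S ] y
      ⊗-intro {Δ} {x} {y} (h , p) (k , q) = ⟨ h , k ⟩ , pair-intro
        (ext (c project₁ project₁ p project₁) (c project₂ project₂ q project₁))
        (ext (c project₁ project₁ p project₂) (c project₂ project₂ q project₂))
        where
        c : ∀ {E F G W Z} {w : Δ ⇒ E} {π : E ⇒ F} {i : F ⇒ G} {j : G ⇒ W} {f : E ⇒ Z} {π′ : Z ⇒ W}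
            {h : Δ ⇒ F} {v : Δ ⇒ G} {z : Δ ⇒ W} →
            f ⨾ π′ ≈ π ⨾ i ⨾ j → w ⨾ π ≈ h → h ⨾ i ≈ v → v ⨾ j ≈ z → (w ⨾ f) ⨾ π′ ≈ z
        c s a b d = trans (pullʳ s) (trans (pullˡ a) (trans (pullˡ b) d))

      ⊗-elim : ∀ {Δ} {x : Δ ⇒ A × B} {y : Δ ⇒ C × D} → x [ R ⊗ S ] y →
               (x ⨾ π₁) [ R ] (y ⨾ π₁) ∧ (x ⨾ π₂) [ S ] (y ⨾ π₂)
      ⊗-elim (h , t) with pair-elim t
      ... | p , q =
        (h ⨾ π₁ , trans η (⟨⟩-cong (c project₁ p) (c project₁ q))) ,
        (h ⨾ π₂ , trans η (⟨⟩-cong (c project₂ p) (c project₂ q)))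
        where
        c : ∀ {Δ E F G W Z} {w : Δ ⇒ E} {π : E ⇒ F} {i : F ⇒ G} {j : G ⇒ W} {f : E ⇒ Z} {π′ : Z ⇒ W}
            {z : Δ ⇒ Z} →
            f ⨾ π′ ≈ π ⨾ i ⨾ j → w ⨾ f ≈ z → ((w ⨾ π) ⨾ i) ⨾ j ≈ z ⨾ π′
        c s a = trans (trans assoc assoc) (trans (⨾-congˡ (sym s)) (pullˡ a))

  swap : ∀ {A B} → A × B ⇒ B × A
  swap = ⟨ π₂ , π₁ ⟩

  assocʳ : ∀ {A B C} → (A × B) × C ⇒ A × (B × C)
  assocʳ = ⟨ π₁ ⨾ π₁ , ⟨ π₁ ⨾ π₂ , π₂ ⟩ ⟩

  assocˡ : ∀ {A B C} → A × (B × C) ⇒ (A × B) × C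
  assocˡ = ⟨ ⟨ π₁ , π₂ ⨾ π₁ ⟩ , π₂ ⨾ π₂ ⟩

  private
    ≋-intro : ∀ {A B} (R S : Relation A B) →
              (∀ {Δ} {x : Δ ⇒ A} {y : Δ ⇒ B} → x [ R ] y → x [ S ] y) →
              (∀ {Δ} {x : Δ ⇒ A} {y : Δ ⇒ B} → x [ S ] y → x [ R ] y) → R ≋ S
    ≋-intro R S p q = ⊆-intro p , ⊆-intro q

  graph-cong : ∀ {A B} {f g : A ⇒ B} → f ≈ g → graph f ≋ graph g
  graph-cong {f = f} {g} p = ≋-intro (graph f) (graph g)
    (λ q → graph-intro (trans (⨾-congˡ (sym p)) (graph-elim q)))
    (λ q → graph-intro (trans (⨾-congˡ p) (graph-elim q)))

  graph-⨾ : ∀ {A B C} {f : A ⇒ B} {g : B ⇒ C} → graph f ⨟ graph g ≋ graph (f ⨾ g)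
  graph-⨾ {f = f} {g} = ≋-intro (graph f ⨟ graph g) (graph (f ⨾ g))
    (λ p → graph-intro (trans sym-assoc (graph-elim (graph-⨟ (graph g) p))))
    (λ p → ⨟-intro (graph f) (graph g) (graph-intro refl)
             (graph-intro (trans assoc (graph-elim p))))

  cograph-⨾ : ∀ {A B C} {f : A ⇒ B} {g : B ⇒ C} → cograph g ⨟ cograph f ≋ cograph (f ⨾ g)
  cograph-⨾ {f = f} {g} = ≋-intro (cograph g ⨟ cograph f) (cograph (f ⨾ g))
    (λ p → cograph-intro (trans sym-assoc (cograph-elim (⨟-cograph (cograph g) p))))
    (λ p → ⨟-intro (cograph g) (cograph f)
             (cograph-intro (trans assoc (cograph-elim p))) (cograph-intro refl))

  graph-⊗ : ∀ {A B C D} {f : A ⇒ C} {g : B ⇒ D} → graph f ⊗ graph g ≋ graph (f ×₁ g)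
  graph-⊗ {f = f} {g} = ≋-intro (graph f ⊗ graph g) (graph (f ×₁ g))
    (λ p → let a , b = ⊗-elim (graph f) (graph g) p in graph-intro
      (trans ⨾⟨⟩ (sym (⟨⟩-unique (trans (sym (graph-elim a)) assoc)
                                 (trans (sym (graph-elim b)) assoc)))))
    (λ p → ⊗-intro (graph f) (graph g)
      (graph-intro (trans (pullʳ (sym project₁)) (pullˡ (graph-elim p))))
      (graph-intro (trans (pullʳ (sym project₂)) (pullˡ (graph-elim p)))))

  cograph-⊗ : ∀ {A B C D} {f : A ⇒ C} {g : B ⇒ D} → cograph f ⊗ cograph g ≋ cograph (f ×₁ g)
  cograph-⊗ {f = f} {g} = ≋-intro (cograph f ⊗ cograph g) (cograph (f ×₁ g))
    (λ p → let a , b = ⊗-elim (cograph f) (cograph g) p in cograph-intro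
      (trans ⨾⟨⟩ (sym (⟨⟩-unique (trans (sym (cograph-elim a)) assoc)
                                 (trans (sym (cograph-elim b)) assoc)))))
    (λ p → ⊗-intro (cograph f) (cograph g)
      (cograph-intro (trans (pullʳ (sym project₁)) (pullˡ (cograph-elim p))))
      (cograph-intro (trans (pullʳ (sym project₂)) (pullˡ (cograph-elim p)))))

  beckChevalley : ∀ {A B C} {f : A ⇒ C} {g : B ⇒ C} (P : Pullback f g) → let open Pullback P in
                  graph f ⨟ cograph g ≋ cograph p₁ ⨟ graph p₂
  beckChevalley {f = f} {g} P =
      ⨟-⊆ (λ a b →
        let s = trans (graph-elim a) (sym (cograph-elim b)) in
        ⨟-intro (cograph p₁) (graph p₂) {y = universal s}
          (cograph-intro (factors₁ s)) (graph-intro (factors₂ s)))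
    , ⨟-⊆ (λ a b →
        ⨟-intro (graph f) (cograph g) (graph-intro refl)
          (cograph-intro (begin
             _ ≈⟨ ⨾-congʳ (graph-elim b) ⟨
             _ ≈⟨ pullʳ (sym commute) ⟩
             _ ≈⟨ pullˡ (cograph-elim a) ⟩
             _ ∎)))
    where open Pullback P

  id⊆graph⨟cograph : ∀ {A B} {f : A ⇒ B} → graph id ⊆ graph f ⨟ cograph f
  id⊆graph⨟cograph {f = f} = ⊆-intro λ p →
    ⨟-intro (graph f) (cograph f) (graph-intro refl)
      (cograph-intro (⨾-congʳ (trans (sym (graph-elim p)) identityʳ)))

  cograph⨟graph⊆id : ∀ {A B} {f : A ⇒ B} → cograph f ⨟ graph f ⊆ graph id
  cograph⨟graph⊆id {f = f} = ⨟-⊆ λ a b →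
    graph-intro (trans identityʳ (trans (sym (cograph-elim a)) (graph-elim b)))

  graph-iso : ∀ {A B} {f : A ⇒ B} {g : B ⇒ A} → f ⨾ g ≈ id → graph f ⨟ graph g ≋ graph id
  graph-iso {f = f} {g} p =
    ≋-trans graph-⨾ (graph-cong p)

  private
    ⨟-mono : ∀ {A B C} {R R′ : Relation A B} {S S′ : Relation B C} →
             R ⊆ R′ → S ⊆ S′ → R ⨟ S ⊆ R′ ⨟ S′
    ⨟-mono {R = R} {R′} {S} {S′} p q = ⨟-⊆ λ a b →
      ⨟-intro R′ S′ (∈-⊆ p a) (∈-⊆ q b)

    ⨟-identityˡ : ∀ {A B} {R : Relation A B} → graph id ⨟ R ≋ R
    ⨟-identityˡ {R = R} = ≋-intro (graph id ⨟ R) R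
      (λ p → []-resp R identityʳ refl (graph-⨟ R p))
      (λ p → ⨟-intro (graph id) R (graph-intro identityʳ) p)

    ⨟-identityʳ : ∀ {A B} {R : Relation A B} → R ⨟ graph id ≋ R
    ⨟-identityʳ {R = R} =
        ⨟-⊆
          (λ a b → []-resp R refl (trans (sym identityʳ) (graph-elim b)) a)
      , ⊆-intro (λ p → ⨟-intro R (graph id) p (graph-intro identityʳ))

    ⨟-assoc : ∀ {A B C D} {R : Relation A B} {S : Relation B C} {T : Relation C D} →
              (R ⨟ S) ⨟ T ≋ R ⨟ (S ⨟ T)
    ⨟-assoc {R = R} {S} {T} =
        ⨟-⊆ (λ a b →
          let _ , q , _ , r , c , d = ⨟-elim R S a in
          []-descend (R ⨟ (S ⨟ T)) r
            (⨟-intro R (S ⨟ T) c (⨟-intro S T d ([]-reindex T q b))))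
      , ⨟-⊆ (λ a b →
          let _ , q , _ , r , c , d = ⨟-elim S T b in
          []-descend ((R ⨟ S) ⨟ T) r
            (⨟-intro (R ⨟ S) T (⨟-intro R S ([]-reindex R q a) c) d))

    ⊗-mono : ∀ {A B C D} {R R′ : Relation A C} {S S′ : Relation B D} →
             R ⊆ R′ → S ⊆ S′ → R ⊗ S ⊆ R′ ⊗ S′
    ⊗-mono {R = R} {R′} {S} {S′} p q = ⊆-intro λ t →
      let a , b = ⊗-elim R S t in
      ⊗-intro R′ S′ (∈-⊆ p a) (∈-⊆ q b)

    ×₁-id : ∀ {A B} → id {A} ×₁ id {B} ≈ id
    ×₁-id = ext (trans project₁ (trans identityʳ (sym identityˡ)))
                (trans project₂ (trans identityʳ (sym identityˡ)))

    ⊗-id : ∀ {A B} → graph (id {A}) ⊗ graph (id {B}) ≋ graph id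
    ⊗-id = ≋-trans graph-⊗ (graph-cong ×₁-id)

    ⊗-⨟ : ∀ {A B C A′ B′ C′} {R : Relation A B} {S : Relation B C}
          {R′ : Relation A′ B′} {S′ : Relation B′ C′} →
          (R ⨟ S) ⊗ (R′ ⨟ S′) ≋ (R ⊗ R′) ⨟ (S ⊗ S′)
    ⊗-⨟ {R = R} {S} {R′} {S′} =
        ⊆-intro (λ t →
          let a , b = ⊗-elim (R ⨟ S) (R′ ⨟ S′) t
              _ , q , _ , r , c , d = ⨟-elim R S a
              _ , q′ , _ , r′ , c′ , d′ = ⨟-elim R′ S′ ([]-reindex (R′ ⨟ S′) q b)
          in []-descend T r ([]-descend T r′ (⨟-intro (R ⊗ R′) (S ⊗ S′)
               (⊗-intro R R′ {y = ⟨ _ , _ ⟩}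
                  ([]-resp R (trans (⨾-congˡ sym-assoc) sym-assoc) (sym project₁) ([]-reindex R q′ c))
                  ([]-resp R′ (trans (⨾-congˡ sym-assoc) sym-assoc) (sym project₂) c′))
               (⊗-intro S S′ {x = ⟨ _ , _ ⟩}
                  ([]-resp S (sym project₁) (trans (⨾-congˡ sym-assoc) sym-assoc) ([]-reindex S q′ d))
                  ([]-resp S′ (sym project₂) (trans (⨾-congˡ sym-assoc) sym-assoc) d′)))))
      , ⨟-⊆ (λ s t →
          let a , b = ⊗-elim R R′ s
              c , d = ⊗-elim S S′ t
          in ⊗-intro (R ⨟ S) (R′ ⨟ S′) (⨟-intro R S a c) (⨟-intro R′ S′ b d))
      where T = (R ⊗ R′) ⨟ (S ⊗ S′)

    natural : ∀ {A A′ B B′} {f : A ⇒ A′} {f′ : B ⇒ B′} {g′ : B′ ⇒ B}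
              (R : Relation A B) (S : Relation A′ B′) →
              f′ ⨾ g′ ≈ id → g′ ⨾ f′ ≈ id →
              (∀ {Δ} {x : Δ ⇒ A} {y : Δ ⇒ B} → x [ R ] y → (x ⨾ f) [ S ] (y ⨾ f′)) →
              (∀ {Δ} {x : Δ ⇒ A} {y : Δ ⇒ B′} → (x ⨾ f) [ S ] y → x [ R ] (y ⨾ g′)) →
              R ⨟ graph f′ ≋ graph f ⨟ S
    natural {f = f} {f′} R S i j to from =
        ⨟-⊆ (λ a b →
          ⨟-intro (graph f) S (graph-intro refl) ([]-resp S refl (graph-elim b) (to a)))
      , ⊆-intro (λ p →
          ⨟-intro R (graph f′) (from (graph-⨟ S p))
            (graph-intro (trans (pullʳ j) identityʳ)))

    assocʳ-π₁ : ∀ {A B C X} {x : X ⇒ (A × B) × C} → (x ⨾ assocʳ) ⨾ π₁ ≈ (x ⨾ π₁) ⨾ π₁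
    assocʳ-π₁ = trans (pullʳ project₁) sym-assoc

    assocʳ-π₂₁ : ∀ {A B C X} {x : X ⇒ (A × B) × C} → ((x ⨾ assocʳ) ⨾ π₂) ⨾ π₁ ≈ (x ⨾ π₁) ⨾ π₂
    assocʳ-π₂₁ = trans (⨾-congʳ (pullʳ project₂)) (trans (pullʳ project₁) sym-assoc)

    assocʳ-π₂₂ : ∀ {A B C X} {x : X ⇒ (A × B) × C} → ((x ⨾ assocʳ) ⨾ π₂) ⨾ π₂ ≈ x ⨾ π₂
    assocʳ-π₂₂ = trans (⨾-congʳ (pullʳ project₂)) (pullʳ project₂)

    assocˡ-π₁₁ : ∀ {A B C X} {x : X ⇒ A × (B × C)} → ((x ⨾ assocˡ) ⨾ π₁) ⨾ π₁ ≈ x ⨾ π₁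
    assocˡ-π₁₁ = trans (⨾-congʳ (pullʳ project₁)) (pullʳ project₁)

    assocˡ-π₁₂ : ∀ {A B C X} {x : X ⇒ A × (B × C)} → ((x ⨾ assocˡ) ⨾ π₁) ⨾ π₂ ≈ (x ⨾ π₂) ⨾ π₁
    assocˡ-π₁₂ = trans (⨾-congʳ (pullʳ project₁)) (trans (pullʳ project₂) sym-assoc)

    assocˡ-π₂ : ∀ {A B C X} {x : X ⇒ A × (B × C)} → (x ⨾ assocˡ) ⨾ π₂ ≈ (x ⨾ π₂) ⨾ π₂
    assocˡ-π₂ = trans (pullʳ project₂) sym-assoc

    ⟨⟩-assocʳ : ∀ {A B C X} {x : X ⇒ A} {y : X ⇒ B} {z : X ⇒ C} →
                ⟨ ⟨ x , y ⟩ , z ⟩ ⨾ assocʳ ≈ ⟨ x , ⟨ y , z ⟩ ⟩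
    ⟨⟩-assocʳ = trans ⨾⟨⟩ (⟨⟩-cong (trans (pullˡ project₁) project₁)
      (trans ⨾⟨⟩ (⟨⟩-cong (trans (pullˡ project₁) project₂) project₂)))

    ⟨⟩-assocˡ : ∀ {A B C X} {x : X ⇒ A} {y : X ⇒ B} {z : X ⇒ C} →
                ⟨ x , ⟨ y , z ⟩ ⟩ ⨾ assocˡ ≈ ⟨ ⟨ x , y ⟩ , z ⟩
    ⟨⟩-assocˡ = trans ⨾⟨⟩ (⟨⟩-cong
      (trans ⨾⟨⟩ (⟨⟩-cong project₁ (trans (pullˡ project₂) project₁)))
      (trans (pullˡ project₂) project₂))

    ⟨⟩-swap : ∀ {A B X} {x : X ⇒ A} {y : X ⇒ B} → ⟨ x , y ⟩ ⨾ swap ≈ ⟨ y , x ⟩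
    ⟨⟩-swap = trans ⨾⟨⟩ (⟨⟩-cong project₂ project₁)

    tuple₂ : ∀ {A B} → ⟨ π₁ {A} {B} , π₂ ⟩ ≈ id
    tuple₂ = sym (⟨⟩-unique identityˡ identityˡ)

    onTuple : ∀ {A B} {f g u : A ⇒ B} →
              ∀ {i : A ⇒ A} → i ≈ id → i ⨾ f ≈ u → i ⨾ g ≈ u → f ≈ g
    onTuple p q s = trans (sym identityˡ) (trans (⨾-congʳ (sym p))
      (trans q (trans (sym s) (trans (⨾-congʳ p) identityˡ))))

    tuple₃ : ∀ {A B C} → ⟨ ⟨ π₁ {A × B} {C} ⨾ π₁ , π₁ ⨾ π₂ ⟩ , π₂ ⟩ ≈ id
    tuple₃ = trans (⟨⟩-cong (sym η) refl) tuple₂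

    tuple₃′ : ∀ {A B C} → ⟨ π₁ {A} {B × C} , ⟨ π₂ ⨾ π₁ , π₂ ⨾ π₂ ⟩ ⟩ ≈ id
    tuple₃′ = trans (⟨⟩-cong refl (sym η)) tuple₂

    tuple₄ : ∀ {A B C D} →
      ⟨ ⟨ ⟨ (π₁ {(A × B) × C} {D} ⨾ π₁) ⨾ π₁ , (π₁ ⨾ π₁) ⨾ π₂ ⟩ , π₁ ⨾ π₂ ⟩ , π₂ ⟩ ≈ id
    tuple₄ = trans (⟨⟩-cong (⟨⟩-cong (sym η) refl) refl) tuple₃

    infixr 5 _then_
    _then_ : ∀ {A B C D} {t : A ⇒ B} {f : B ⇒ C} {g : C ⇒ D} {u : A ⇒ C} {v : A ⇒ D} →
             t ⨾ f ≈ u → u ⨾ g ≈ v → t ⨾ f ⨾ g ≈ v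
    p then q = trans (pullˡ p) q

    assoc-iso₁ : ∀ {A B C} → assocʳ {A} {B} {C} ⨾ assocˡ ≈ id
    assoc-iso₁ = onTuple tuple₃ (⟨⟩-assocʳ then ⟨⟩-assocˡ) identityʳ

    assoc-iso₂ : ∀ {A B C} → assocˡ {A} {B} {C} ⨾ assocʳ ≈ id
    assoc-iso₂ = onTuple tuple₃′ (⟨⟩-assocˡ then ⟨⟩-assocʳ) identityʳ

    swap-iso : ∀ {A B} → swap {A} {B} ⨾ swap ≈ id
    swap-iso = onTuple tuple₂ (⟨⟩-swap then ⟨⟩-swap) identityʳ

    graphs : ∀ {A B C} {R : Relation A B} {S : Relation B C} {f : A ⇒ B} {g : B ⇒ C} →
             R ≋ graph f → S ≋ graph g → R ⨟ S ≋ graph (f ⨾ g)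
    graphs (p , p′) (q , q′) = ≋-trans (⨟-mono p q , ⨟-mono p′ q′) graph-⨾

    byMaps : ∀ {A B} {R S : Relation A B} {f g : A ⇒ B} →
             R ≋ graph f → S ≋ graph g → f ≈ g → R ≋ S
    byMaps p q s = ≋-trans p (≋-trans (graph-cong s) (≋-sym q))

  Rel : SymmetricMonoidalPoCategory o (o ⊔ ℓ ⊔ e) (ℓ ⊔ e) (ℓ ⊔ e)
  Rel = record
    { poCategory = record
      { Obj       = Obj
      ; Hom       = λ A B → subobjects (A × B)
      ; id        = graph id
      ; _⨾_       = _⨟_
      ; ⨾-mono    = ⨟-mono
      ; identityˡ = ⨟-identityˡ
      ; identityʳ = ⨟-identityʳ
      ; assoc     = λ {_} {_} {_} {_} {R} {S} {T} → ⨟-assoc {R = R} {S} {T}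
      }
    ; symmetric = record
      { unit = ⊤
      ; _⊗₀_ = _×_
      ; _⊗₁_ = _⊗_
      ; ⊗-mono = ⊗-mono
      ; ⊗-id = ⊗-id
      ; ⊗-⨾ = ⊗-⨟
      ; α   = graph assocʳ
      ; α⁻¹ = graph assocˡ
      ; l   = graph π₂
      ; l⁻¹ = graph ⟨ ! , id ⟩
      ; r   = graph π₁
      ; r⁻¹ = graph ⟨ id , ! ⟩
      ; σ   = graph swap
      ; α-isoˡ = graph-iso assoc-iso₁
      ; α-isoʳ = graph-iso assoc-iso₂
      ; l-isoˡ = graph-iso l-iso
      ; l-isoʳ = graph-iso project₂
      ; r-isoˡ = graph-iso r-iso
      ; r-isoʳ = graph-iso project₁
      ; σ-inv  = graph-iso swap-iso
      ; α-natural = λ {_} {_} {_} {_} {_} {_} {R} {S} {T} →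
          natural ((R ⊗ S) ⊗ T) (R ⊗ (S ⊗ T)) assoc-iso₁ assoc-iso₂
            (λ t → let u , c = ⊗-elim (R ⊗ S) T t
                       a , b = ⊗-elim R S u
              in ⊗-intro R (S ⊗ T) ([]-resp R (sym assocʳ-π₁) (sym assocʳ-π₁) a)
                   (⊗-intro S T ([]-resp S (sym assocʳ-π₂₁) (sym assocʳ-π₂₁) b)
                                ([]-resp T (sym assocʳ-π₂₂) (sym assocʳ-π₂₂) c)))
            (λ t → let a , u = ⊗-elim R (S ⊗ T) t
                       b , c = ⊗-elim S T u
              in ⊗-intro (R ⊗ S) T
                   (⊗-intro R S ([]-resp R assocʳ-π₁ (sym assocˡ-π₁₁) a)
                                ([]-resp S assocʳ-π₂₁ (sym assocˡ-π₁₂) b))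
                   ([]-resp T assocʳ-π₂₂ (sym assocˡ-π₂) c))
      ; l-natural = λ {_} {_} {R} → natural (graph id ⊗ R) R l-iso project₂
          (λ t → proj₂ (⊗-elim (graph id) R t))
          (λ t → ⊗-intro (graph id) R (graph-intro !-unique)
                   ([]-resp R refl (sym (trans (pullʳ project₂) identityʳ)) t))
      ; r-natural = λ {_} {_} {R} → natural (R ⊗ graph id) R r-iso project₁
          (λ t → proj₁ (⊗-elim R (graph id) t))
          (λ t → ⊗-intro R (graph id)
                   ([]-resp R refl (sym (trans (pullʳ project₁) identityʳ)) t)
                   (graph-intro !-unique))
      ; σ-natural = λ {_} {_} {_} {_} {R} {S} → natural (R ⊗ S) (S ⊗ R) swap-iso swap-iso
          (λ t → let a , b = ⊗-elim R S t in ⊗-intro S R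
                   ([]-resp S (sym (pullʳ project₁)) (sym (pullʳ project₁)) b)
                   ([]-resp R (sym (pullʳ project₂)) (sym (pullʳ project₂)) a))
          (λ t → let b , a = ⊗-elim S R t in ⊗-intro R S
                   ([]-resp R (pullʳ project₂) (sym (pullʳ project₁)) a)
                   ([]-resp S (pullʳ project₁) (sym (pullʳ project₂)) b))
      ; pentagon = byMaps
          (graphs graph-⊗
            (graphs ≋-refl graph-⊗))
          graph-⨾
          (onTuple tuple₄
            (trans ⟨⟩×₁ (⟨⟩-cong ⟨⟩-assocʳ identityʳ)
              then ⟨⟩-assocʳ then trans ⟨⟩×₁ (⟨⟩-cong identityʳ ⟨⟩-assocʳ))
            (⟨⟩-assocʳ then ⟨⟩-assocʳ))
      ; triangle = byMaps
          (graphs ≋-refl graph-⊗) graph-⊗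
          (onTuple tuple₃
            (⟨⟩-assocʳ then trans ⟨⟩×₁ (⟨⟩-cong identityʳ project₂))
            (trans ⟨⟩×₁ (⟨⟩-cong project₁ identityʳ)))
      ; hexagon = byMaps
          (graphs ≋-refl graph-⨾)
          (graphs graph-⊗
            (graphs ≋-refl graph-⊗))
          (onTuple tuple₃
            (⟨⟩-assocʳ then ⟨⟩-swap then ⟨⟩-assocʳ)
            (trans ⟨⟩×₁ (⟨⟩-cong ⟨⟩-swap identityʳ)
              then ⟨⟩-assocʳ then trans ⟨⟩×₁ (⟨⟩-cong identityʳ ⟨⟩-swap)))
      }
    }
    where
    l-iso : ∀ {A} → π₂ {⊤} {A} ⨾ ⟨ ! , id ⟩ ≈ id
    l-iso = ext !-unique (trans (pullʳ project₂) (trans identityʳ (sym identityˡ)))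
    r-iso : ∀ {A} → π₁ {A} {⊤} ⨾ ⟨ id , ! ⟩ ≈ id
    r-iso = ext (trans (pullʳ project₁) (trans identityʳ (sym identityˡ))) !-unique

open import Data.Empty using (⊥-elim)
open import Data.Fin.Base
  using (Fin; zero; _↑ˡ_; _↑ʳ_; splitAt; punchIn; punchOut) renaming (suc to fsuc)
open import Data.Fin.Properties
  using (_≟_; any?; splitAt-↑ˡ; splitAt-↑ʳ; splitAt⁻¹-↑ˡ; splitAt⁻¹-↑ʳ; ↑ˡ-injective;
         punchInᵢ≢i; punchOut-cong; punchOut-punchIn; punchIn-punchOut)
open import Data.List.Base using (List; []; _++_)
open import Data.List.Membership.Propositional using () renaming (_∈_ to _∈ˡ_)
open import Data.List.Membership.Propositional.Properties using (∈-++⁺ˡ; ∈-++⁺ʳ; ∈-++⁻)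
open import Data.List.Relation.Binary.Subset.Propositional using () renaming (_⊆_ to _⊆ˡ_)
open import Data.Nat.Base using (ℕ; _+_) renaming (suc to nsuc)
open import Data.Sum.Base using (inj₁; inj₂; [_,_]′)
open import Function using (_∘_)
open import Relation.Binary.PropositionalEquality
  using (_≡_; _≗_; refl; sym; trans; cong)
open import Relation.Nullary using (yes; no)

-- The quotient of Fin n by the equivalence relation generated by f i ~ g i.
record Quotient (a : Level) {m n} (f g : Fin m → Fin n) : Set (suc a) where
  field
    size      : ℕ
    class     : Fin n → Fin size
    rep       : Fin size → Fin n
    class-rep : ∀ k → class (rep k) ≡ k
    glue      : ∀ i → class (f i) ≡ class (g i)
    respect   : ∀ {A : Set a} (h : Fin n → A) → (∀ i → h (f i) ≡ h (g i)) →
                ∀ j → h (rep (class j)) ≡ h j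

  respectFin : ∀ {k} (h : Fin n → Fin k) → (∀ i → h (f i) ≡ h (g i)) →
               ∀ j → h (rep (class j)) ≡ h j
  respectFin h p j = cong lower (respect (lift ∘ h) (λ i → cong lift (p i)) j)

identify : ∀ {a n} (i j : Fin n) → Quotient a {1} (λ _ → i) (λ _ → j)
identify {n = nsuc n} i j with i ≟ j
... | yes i≡j = record
  { size      = nsuc n
  ; class     = λ k → k
  ; rep       = λ k → k
  ; class-rep = λ _ → refl
  ; glue      = λ _ → i≡j
  ; respect   = λ _ _ _ → refl
  }
... | no i≢j = record
  { size      = n
  ; class     = class
  ; rep       = punchIn j
  ; class-rep = class-rep
  ; glue      = λ _ → glue
  ; respect   = λ h p → respect h (p zero)
  }
  where
  class : Fin (nsuc n) → Fin n
  class k with j ≟ k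
  ... | yes _  = punchOut (i≢j ∘ sym)
  ... | no j≢k = punchOut j≢k

  class-rep : ∀ k → class (punchIn j k) ≡ k
  class-rep k with j ≟ punchIn j k
  ... | yes p  = ⊥-elim (punchInᵢ≢i j k (sym p))
  ... | no j≢k = trans (punchOut-cong j refl) (punchOut-punchIn j)

  glue : class i ≡ class j
  glue with j ≟ i | j ≟ j
  ... | yes p | _     = ⊥-elim (i≢j (sym p))
  ... | no _  | yes _ = punchOut-cong j refl
  ... | no _  | no ¬p = ⊥-elim (¬p refl)

  respect : ∀ {b} {A : Set b} (h : Fin (nsuc n) → A) → h i ≡ h j →
            ∀ k → h (punchIn j (class k)) ≡ h k
  respect h p k with j ≟ k
  ... | yes refl = trans (cong h (punchIn-punchOut (i≢j ∘ sym))) p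
  ... | no j≢k   = cong h (punchIn-punchOut j≢k)

quotient : ∀ {a m n} (f g : Fin m → Fin n) → Quotient a f g
quotient {m = 0} {n} f g = record
  { size      = n
  ; class     = λ k → k
  ; rep       = λ k → k
  ; class-rep = λ _ → refl
  ; glue      = λ ()
  ; respect   = λ _ _ _ → refl
  }
quotient {a} {m = nsuc m} f g = record
  { size      = I.size
  ; class     = I.class ∘ Q.class
  ; rep       = Q.rep ∘ I.rep
  ; class-rep = λ k → trans (cong I.class (Q.class-rep (I.rep k))) (I.class-rep k)
  ; glue      = λ { zero → I.glue zero ; (fsuc i) → cong I.class (Q.glue i) }
  ; respect   = λ h p j →
      let r = Q.respect h (p ∘ fsuc) in
      trans (I.respect (h ∘ Q.rep)
              (λ _ → trans (r (f zero)) (trans (p zero) (sym (r (g zero))))) (Q.class j))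
            (r j)
  }
  where
  module Q = Quotient (quotient {a} (f ∘ fsuc) (g ∘ fsuc))
  module I = Quotient (identify {a} (Q.class (f zero)) (Q.class (g zero)))

record FinImage {m n} (f : Fin m → Fin n) : Set where
  field
    size      : ℕ
    incl      : Fin size → Fin n
    preimage  : Fin size → Fin m
    cover     : Fin m → Fin size
    injective : ∀ {k l} → incl k ≡ incl l → k ≡ l
    f-preimage : ∀ k → f (preimage k) ≡ incl k
    factors   : ∀ i → incl (cover i) ≡ f i

finImage : ∀ {m n} (f : Fin m → Fin n) → FinImage f
finImage {0} f = record
  { size = 0 ; incl = λ () ; preimage = λ () ; cover = λ ()
  ; injective = λ { {()} } ; f-preimage = λ () ; factors = λ () }
finImage {nsuc m} {n} f with any? (λ k → FinImage.incl (finImage (f ∘ fsuc)) k ≟ f zero)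
... | yes (k , p) = record
  { size = I.size ; incl = I.incl ; preimage = fsuc ∘ I.preimage
  ; cover = λ { zero → k ; (fsuc i) → I.cover i }
  ; injective = I.injective ; f-preimage = I.f-preimage
  ; factors = λ { zero → p ; (fsuc i) → I.factors i } }
  where module I = FinImage (finImage (f ∘ fsuc))
... | no ¬p = record
  { size = nsuc I.size
  ; incl = incl
  ; preimage = λ { zero → zero ; (fsuc k) → fsuc (I.preimage k) }
  ; cover = λ { zero → zero ; (fsuc i) → fsuc (I.cover i) }
  ; injective = injective
  ; f-preimage = λ { zero → refl ; (fsuc k) → I.f-preimage k }
  ; factors = λ { zero → refl ; (fsuc i) → I.factors i } }
  where
  module I = FinImage (finImage (f ∘ fsuc))
  incl : Fin (nsuc I.size) → Fin n
  incl zero     = f zero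
  incl (fsuc k) = I.incl k
  injective : ∀ {k l} → incl k ≡ incl l → k ≡ l
  injective {zero}   {zero}   _ = refl
  injective {zero}   {fsuc l} p = ⊥-elim (¬p (l , sym p))
  injective {fsuc k} {zero}   p = ⊥-elim (¬p (k , p))
  injective {fsuc k} {fsuc l} p = cong fsuc (I.injective p)

module FreeRegular {t} (T : Set t) where

  -- The finite set S ⊆ T is given by a list of its elements; contexts whose
  -- lists have the same elements are isomorphic.
  record Context : Set t where
    field
      size    : ℕ
      support : List T
      sort    : Fin size → T
      sort∈   : ∀ i → sort i ∈ˡ support

  open Context

  infix 4 _⟶_
  record _⟶_ (Γ Γ′ : Context) : Set t where
    field
      support⊇ : support Γ′ ⊆ˡ support Γ
      map      : Fin (size Γ′) → Fin (size Γ)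
      map-sort : ∀ i → sort Γ (map i) ≡ sort Γ′ i

  open _⟶_

  ctxCategory : Category t t Level.zero
  ctxCategory = record
    { Obj = Context
    ; _⇒_ = _⟶_
    ; _≈_ = λ f g → map f ≗ map g
    ; id  = record { support⊇ = λ x → x ; map = λ i → i ; map-sort = λ _ → refl }
    ; _⨾_ = λ f g → record
        { support⊇ = λ x → support⊇ f (support⊇ g x)
        ; map      = map f ∘ map g
        ; map-sort = λ i → trans (map-sort f (map g i)) (map-sort g i)
        }
    ; equiv = record
        { refl = λ _ → refl ; sym = λ p i → sym (p i) ; trans = λ p q i → trans (p i) (q i) }
    ; ⨾-cong = λ {_} {_} {_} {f} {_} {_} {g′} p q i → trans (cong (map f) (q i)) (p (map g′ i))
    ; identityˡ = λ _ → refl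
    ; identityʳ = λ _ → refl
    ; assoc     = λ _ → refl
    }

  open Category ctxCategory using (_⇒_; _≈_; _⨾_)

  ctxTerminal : Terminal ctxCategory
  ctxTerminal = record
    { ⊤ = record { size = 0 ; support = [] ; sort = λ () ; sort∈ = λ () }
    ; ! = record { support⊇ = λ () ; map = λ () ; map-sort = λ () }
    ; !-unique = λ ()
    }

  infixr 7 _⊕_
  _⊕_ : Context → Context → Context
  Γ ⊕ Γ′ = record
    { size    = size Γ + size Γ′
    ; support = support Γ ++ support Γ′
    ; sort    = λ i → [ sort Γ , sort Γ′ ]′ (splitAt (size Γ) i)
    ; sort∈   = λ i → s∈ (splitAt (size Γ) i)
    }
    where
    s∈ : ∀ x → [ sort Γ , sort Γ′ ]′ x ∈ˡ support Γ ++ support Γ′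
    s∈ (inj₁ i) = ∈-++⁺ˡ (sort∈ Γ i)
    s∈ (inj₂ j) = ∈-++⁺ʳ (support Γ) (sort∈ Γ′ j)

  ctxProduct : ∀ Γ Γ′ → Product ctxCategory Γ Γ′
  ctxProduct Γ Γ′ = record
    { A×B = Γ ⊕ Γ′
    ; π₁ = record
        { support⊇ = ∈-++⁺ˡ ; map = _↑ˡ size Γ′
        ; map-sort = λ i → cong [ sort Γ , sort Γ′ ]′ (splitAt-↑ˡ (size Γ) i (size Γ′)) }
    ; π₂ = record
        { support⊇ = ∈-++⁺ʳ (support Γ) ; map = size Γ ↑ʳ_
        ; map-sort = λ i → cong [ sort Γ , sort Γ′ ]′ (splitAt-↑ʳ (size Γ) (size Γ′) i) }
    ; ⟨_,_⟩ = λ f g → record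
        { support⊇ = λ x → [ (λ y → support⊇ f y) , (λ y → support⊇ g y) ]′ (∈-++⁻ (support Γ) x)
        ; map      = [ map f , map g ]′ ∘ splitAt (size Γ)
        ; map-sort = λ i → pair-sort f g (splitAt (size Γ) i)
        }
    ; project₁ = λ {_} {f} {g} i → cong [ map f , map g ]′ (splitAt-↑ˡ (size Γ) i (size Γ′))
    ; project₂ = λ {_} {f} {g} i → cong [ map f , map g ]′ (splitAt-↑ʳ (size Γ) (size Γ′) i)
    ; unique = λ {_} {f} {g} {h} p q i → pair-unique f g h p q i
    }
    where
    pair-sort : ∀ {X} (f : X ⇒ Γ) (g : X ⇒ Γ′) x →
                sort X ([ map f , map g ]′ x) ≡ [ sort Γ , sort Γ′ ]′ x
    pair-sort f g (inj₁ i) = map-sort f i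
    pair-sort f g (inj₂ j) = map-sort g j
    pair-unique : ∀ {X} (f : X ⇒ Γ) (g : X ⇒ Γ′) (h : X ⇒ Γ ⊕ Γ′) →
                  map h ∘ (_↑ˡ size Γ′) ≗ map f → map h ∘ (size Γ ↑ʳ_) ≗ map g →
                  ∀ i → map h i ≡ [ map f , map g ]′ (splitAt (size Γ) i)
    pair-unique f g h p q i with splitAt (size Γ) i in eq
    ... | inj₁ j = trans (cong (map h) (sym (splitAt⁻¹-↑ˡ eq))) (p j)
    ... | inj₂ j = trans (cong (map h) (sym (splitAt⁻¹-↑ʳ eq))) (q j)

  ctxEqualizer : ∀ {Γ Γ′} (f g : Γ ⇒ Γ′) → Equalizer ctxCategory f g
  ctxEqualizer {Γ} {Γ′} f g = record
    { E = record
        { size = Q.size ; support = support Γ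
        ; sort = sort Γ ∘ Q.rep ; sort∈ = sort∈ Γ ∘ Q.rep }
    ; eq = record
        { support⊇ = λ x → x ; map = Q.class
        ; map-sort = Q.respect (sort Γ) λ i → trans (map-sort f i) (sym (map-sort g i)) }
    ; equality = Q.glue
    ; universal = λ {_} {h} p → record
        { support⊇ = support⊇ h ; map = map h ∘ Q.rep ; map-sort = map-sort h ∘ Q.rep }
    ; factors = λ {_} {h} p → Q.respectFin (map h) p
    ; unique = λ {_} {h} {_} {k} p i → trans (cong (map k) (sym (Q.class-rep i))) (p (Q.rep i))
    }
    where module Q = Quotient (quotient {t} (map f) (map g))

  private
    Injective : ∀ {Γ Γ′} → Γ ⇒ Γ′ → Set
    Injective f = ∀ {i j} → map f i ≡ map f j → i ≡ j

    Image? : ∀ {Γ Γ′} → Γ ⇒ Γ′ → Fin (size Γ) → Set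
    Image? f j = ∃ λ i → map f i ≡ j

    record ImageOf {Γ Γ′} (f : Γ ⇒ Γ′) : Set t where
      field
        img       : Context
        e         : Γ ⇒ img
        m         : img ⇒ Γ′
        factors   : e ⨾ m ≈ f
        hits      : ∀ i → Image? f (map e i)
        injective : Injective e
        saturated : support Γ ⊆ˡ support img

    imageOf : ∀ {Γ Γ′} (f : Γ ⇒ Γ′) → ImageOf f
    imageOf {Γ} f = record
      { img = record
          { size = I.size ; support = support Γ
          ; sort = sort Γ ∘ I.incl ; sort∈ = sort∈ Γ ∘ I.incl }
      ; e = record { support⊇ = λ x → x ; map = I.incl ; map-sort = λ _ → refl }
      ; m = record
          { support⊇ = support⊇ f ; map = I.cover
          ; map-sort = λ i → trans (cong (sort Γ) (I.factors i)) (map-sort f i) }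
      ; factors = I.factors
      ; hits = λ i → I.preimage i , I.f-preimage i
      ; injective = I.injective
      ; saturated = λ x → x
      }
      where module I = FinImage (finImage (map f))

    -- Two maps out of Γ ⊕ Γ that agree exactly on the image of f.
    module Separate {Γ Γ′} (f : Γ ⇒ Γ′) where
      n = size Γ

      left : Γ ⊕ Γ ⇒ Γ
      left = Product.π₁ (ctxProduct Γ Γ)

      pick : Fin n → Fin (n + n)
      pick j with any? (λ i → map f i ≟ j)
      ... | yes _ = j ↑ˡ n
      ... | no _  = n ↑ʳ j

      pick-sort : ∀ j → sort (Γ ⊕ Γ) (pick j) ≡ sort Γ j
      pick-sort j with any? (λ i → map f i ≟ j)
      ... | yes _ = cong [ sort Γ , sort Γ ]′ (splitAt-↑ˡ n j n)
      ... | no _  = cong [ sort Γ , sort Γ ]′ (splitAt-↑ʳ n n j)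

      right : Γ ⊕ Γ ⇒ Γ
      right = record { support⊇ = ∈-++⁺ˡ ; map = pick ; map-sort = pick-sort }

      agree : ∀ i → map left (map f i) ≡ map right (map f i)
      agree i with any? (λ k → map f k ≟ map f i)
      ... | yes _ = refl
      ... | no ¬p = ⊥-elim (¬p (i , refl))

      agree⁻¹ : ∀ j → map left j ≡ map right j → Image? f j
      agree⁻¹ j p with any? (λ k → map f k ≟ j)
      ... | yes q = q
      ... | no _  with () ← trans (sym (splitAt-↑ˡ n j n)) (trans (cong (splitAt n) p) (splitAt-↑ʳ n n j))

    -- Maps h out of Γ landing in the image of an injective e factor through e.
    module Factor {Γ Γ′ X} (e : Γ ⇒ Γ′) (sat : support Γ ⊆ˡ support Γ′)
                  (h : Γ ⇒ X) (hits : ∀ i → Image? e (map h i)) where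
      factor : Γ′ ⇒ X
      factor = record
        { support⊇ = λ x → sat (support⊇ h x)
        ; map      = λ i → proj₁ (hits i)
        ; map-sort = λ i → trans (sym (map-sort e (proj₁ (hits i))))
                             (trans (cong (sort Γ) (proj₂ (hits i))) (map-sort h i))
        }
      commutes : e ⨾ factor ≈ h
      commutes i = proj₂ (hits i)

    regularEpi : ∀ {Γ Γ′} (f : Γ ⇒ Γ′) → Injective f → support Γ ⊆ˡ support Γ′ →
                 RegularEpi ctxCategory f
    regularEpi f inj sat = record
      { f = left ; g = right
      ; isCoequalizer = record
        { equality  = agree
        ; universal = λ {_} {h} p → Factor.factor f sat h (λ i → agree⁻¹ (map h i) (p i))
        ; factors   = λ {_} {h} p → Factor.commutes f sat h (λ i → agree⁻¹ (map h i) (p i))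
        ; unique    = λ {_} {h} {p} q i → inj (trans (q i) (sym (proj₂ (agree⁻¹ (map h i) (p i)))))
        }
      }
      where open Separate f

    regularEpi⁻¹ : ∀ {Γ Γ′} (f : Γ ⇒ Γ′) → RegularEpi ctxCategory f →
                   Injective f ∧ support Γ ⊆ˡ support Γ′
    regularEpi⁻¹ {Γ} {Γ′} f r =
      (λ {i} {j} p → trans (sym (retract i)) (trans (cong (map k) (I.injective
          (trans (I.factors i) (trans p (sym (I.factors j)))))) (retract j)))
      , λ x → support⊇ k (I.saturated x)
      where
      open RegularEpi r using (isCoequalizer) renaming (f to u; g to v)
      open IsCoequalizer isCoequalizer
      module I = ImageOf (imageOf f)
      p : u ⨾ I.e ≈ v ⨾ I.e
      p i with I.hits i
      ... | j , q = trans (cong (map u) (sym q)) (trans (equality j) (cong (map v) q))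
      k : Γ′ ⇒ I.img
      k = universal {h = I.e} p
      retract : ∀ i → map k (map I.m i) ≡ i
      retract i = trans (unique {h = f} {p = equality} {k = k ⨾ I.m}
                           (λ j → trans (factors p (map I.m j)) (I.factors j)) i)
                        (sym (unique {h = f} {p = equality} {k = Category.id ctxCategory}
                           (λ _ → refl) i))

  ctxIsRegular : IsRegular ctxCategory
  ctxIsRegular = record
    { finiteLimits = record
      { terminal = ctxTerminal ; product = ctxProduct ; equalizer = ctxEqualizer }
    ; kernelCoequalizer = λ {_} {_} {_} {f} → kernelCoequalizer f
    ; stable = stable
    }
    where
    kernelCoequalizer : ∀ {A B K} (f : A ⇒ B) {p q : K ⇒ A} →
                        IsPullback ctxCategory f f p q → Coequalizer ctxCategory p q
    kernelCoequalizer {A} f {p} {q} pb = record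
      { coeq = I.e
      ; isCoequalizer = record
        { equality = equality
        ; universal = λ {_} {h} r → Factor.factor I.e I.saturated h (hits h r)
        ; factors = λ {_} {h} r → Factor.commutes I.e I.saturated h (hits h r)
        ; unique = λ {_} {h} {r} s i → I.injective (trans (s i) (sym (proj₂ (hits h r i))))
        }
      }
      where
      module I = ImageOf (imageOf f)
      open IsPullback pb using (commute; universal; factors₁; factors₂)
      open Separate f
      equality : p ⨾ I.e ≈ q ⨾ I.e
      equality i with I.hits i
      ... | j , r = trans (cong (map p) (sym r)) (trans (commute j) (cong (map q) r))
      cone : left ⨾ f ≈ right ⨾ f
      cone = agree
      k = universal {x = left} {right} cone
      hits : ∀ {X} (h : A ⇒ X) → p ⨾ h ≈ q ⨾ h → ∀ i → Image? I.e (map h i)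
      hits h r i with agree⁻¹ (map h i) (trans (sym (factors₁ {x = left} {right} cone (map h i)))
                        (trans (cong (map k) (r i)) (factors₂ {x = left} {right} cone (map h i))))
      ... | j , s = map I.m j , trans (I.factors j) s

    stable : ∀ {A B C P} {f : A ⇒ C} {g : B ⇒ C} {p : P ⇒ A} {q : P ⇒ B} →
             IsPullback ctxCategory f g p q → RegularEpi ctxCategory g → RegularEpi ctxCategory p
    stable {A} {B} {C} {P} {f} {g} {p} {q} pb r =
      regularEpi p inj (λ x → support⊇ k x)
      where
      open IsPullback pb
      g-inj = proj₁ (regularEpi⁻¹ g r)
      g-sat : support B ⊆ˡ support C
      g-sat = proj₂ (regularEpi⁻¹ g r)

      -- A cone in which the variables of A stay distinct.
      W : Context
      W = record
        { size = size A + size B ; support = support A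
        ; sort = sort (A ⊕ B) ; sort∈ = λ i → s∈ (splitAt (size A) i) }
        where
        s∈ : ∀ x → [ sort A , sort B ]′ x ∈ˡ support A
        s∈ (inj₁ i) = sort∈ A i
        s∈ (inj₂ j) = support⊇ f (g-sat (sort∈ B j))

      x : W ⇒ A
      x = record
        { support⊇ = λ z → z ; map = _↑ˡ size B
        ; map-sort = λ i → cong [ sort A , sort B ]′ (splitAt-↑ˡ (size A) i (size B)) }

      y-map : Fin (size B) → Fin (size A + size B)
      y-map j with any? (λ i → map g i ≟ j)
      ... | yes (i , _) = map f i ↑ˡ size B
      ... | no _        = size A ↑ʳ j

      y-sort : ∀ j → sort W (y-map j) ≡ sort B j
      y-sort j with any? (λ i → map g i ≟ j)
      ... | yes (i , s) = trans (map-sort x (map f i)) (trans (map-sort f i)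
                            (trans (sym (map-sort g i)) (cong (sort B) s)))
      ... | no _        = cong [ sort A , sort B ]′ (splitAt-↑ʳ (size A) (size B) j)

      y : W ⇒ B
      y = record { support⊇ = λ z → support⊇ f (g-sat z) ; map = y-map ; map-sort = y-sort }

      square : x ⨾ f ≈ y ⨾ g
      square i with any? (λ k → map g k ≟ map g i)
      ... | yes (k , s) = cong (λ l → map f l ↑ˡ size B) (sym (g-inj s))
      ... | no ¬s       = ⊥-elim (¬s (i , refl))

      k : W ⇒ P
      k = universal {x = x} {y} square

      inj : Injective p
      inj {i} {j} s = ↑ˡ-injective (size B) i j
        (trans (sym (factors₁ {x = x} {y} square i)) (trans (cong (map k) s) (factors₁ {x = x} {y} square j)))

  FRg : RegularCategory t t Level.zero
  FRg = record { category = ctxCategory ; isRegular = ctxIsRegular }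

open FreeRegular public using (FRg)

𝔽Rg : ∀ {t} → Set t → SymmetricMonoidalPoCategory t t t t
𝔽Rg T = Relations.Rel (FRg T)

module InternalRelations {o ℓ e c ℓ₁ ℓ₂} (ℛ : RegularCategory o ℓ e)
  (P : AjaxPoFunctor (Relations.Rel ℛ) (POSET c ℓ₁ ℓ₂)) where
  open RegularCategory ℛ
  open RegularTools ℛ renaming (! to bang)
  open Relations ℛ
  open AjaxPoFunctor P
  open PosetHomomorphism using (⟦_⟧)

  Pred : Obj → Set c
  Pred Γ = Poset.Carrier (F₀ Γ)

  infix 4 _⊢_ _≃_
  _⊢_ : ∀ {Γ} → Pred Γ → Pred Γ → Set ℓ₂
  _⊢_ {Γ} = Poset._≤_ (F₀ Γ)

  _≃_ : ∀ {Γ} → Pred Γ → Pred Γ → Set ℓ₁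
  _≃_ {Γ} = Poset._≈_ (F₀ Γ)

  infixr 8 _! _*
  _! : ∀ {Γ Γ′} → Γ ⇒ Γ′ → Pred Γ → Pred Γ′
  f ! = ⟦ F₁ (graph f) ⟧

  _* : ∀ {Γ Γ′} → Γ ⇒ Γ′ → Pred Γ′ → Pred Γ
  f * = ⟦ F₁ (cograph f) ⟧

  infixr 7 _⊠_
  _⊠_ : ∀ {Γ Γ′} → Pred Γ → Pred Γ′ → Pred (Γ × Γ′)
  θ ⊠ θ′ = ⟦ ρ ⟧ (θ , θ′)

  -- Γ₁ ⊕ δ ⊕ Γ₃ with its codomain rebracketed to fit the laxator.
  Γ⊕δ⊕Γ : ∀ {Γ₁ Γ₂ Γ₃} → Γ₁ × (Γ₂ × Γ₃) ⇒ (Γ₁ × Γ₂) × (Γ₂ × Γ₃)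
  Γ⊕δ⊕Γ = ⟨ ⟨ π₁ , π₂ ⨾ π₁ ⟩ , π₂ ⟩

  π₁₃ : ∀ {Γ₁ Γ₂ Γ₃} → Γ₁ × (Γ₂ × Γ₃) ⇒ Γ₁ × Γ₃
  π₁₃ = ⟨ π₁ , π₂ ⨾ π₂ ⟩

  infixr 9 _⨟ᵢ_
  _⨟ᵢ_ : ∀ {Γ₁ Γ₂ Γ₃} → Pred (Γ₁ × Γ₂) → Pred (Γ₂ × Γ₃) → Pred (Γ₁ × Γ₃)
  θ ⨟ᵢ θ′ = (π₁₃ !) ((Γ⊕δ⊕Γ *) (θ ⊠ θ′))

  idᵢ : ∀ {Γ} → Pred Γ → Pred (Γ × Γ)
  idᵢ φ = (δ !) φ

  Supported : ∀ {Γ₁ Γ₂} → Pred Γ₁ → Pred Γ₂ → Pred (Γ₁ × Γ₂) → Set ℓ₂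
  Supported φ₁ φ₂ θ = (π₁ !) θ ⊢ φ₁ ∧ (π₂ !) θ ⊢ φ₂

  module Logic where
    module _ {Γ : Obj} where
      open Poset (F₀ Γ) public using ()
        renaming (refl to ⊢-refl; trans to ⊢-trans; reflexive to ≃⇒⊢; antisym to ⊢-antisym)
      open Poset.Eq (F₀ Γ) public using () renaming (sym to ≃-sym; trans to ≃-trans; refl to ≃-refl)

    !-mono : ∀ {Γ Γ′} {f : Γ ⇒ Γ′} {θ χ} → θ ⊢ χ → (f !) θ ⊢ (f !) χ
    !-mono {f = f} = PosetHomomorphism.mono (F₁ (graph f))

    *-mono : ∀ {Γ Γ′} {f : Γ ⇒ Γ′} {θ χ} → θ ⊢ χ → (f *) θ ⊢ (f *) χ
    *-mono {f = f} = PosetHomomorphism.mono (F₁ (cograph f))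

    ⊠-mono : ∀ {Γ Γ′} {θ χ : Pred Γ} {θ′ χ′ : Pred Γ′} → θ ⊢ χ → θ′ ⊢ χ′ → θ ⊠ θ′ ⊢ χ ⊠ χ′
    ⊠-mono p q = PosetHomomorphism.mono ρ (p , q)

    *-cong : ∀ {Γ Γ′} {f g : Γ ⇒ Γ′} {θ} → f ≈ g → (f *) θ ⊢ (g *) θ
    *-cong {θ = θ} p = F-mono (⊆-intro λ q →
      cograph-intro (Equiv.trans (⨾-congˡ (Equiv.sym p)) (cograph-elim q))) θ

    *-⨾ : ∀ {Γ₁ Γ₂ Γ₃} {f : Γ₁ ⇒ Γ₂} {g : Γ₂ ⇒ Γ₃} {θ} → ((f ⨾ g) *) θ ≃ (f *) ((g *) θ)
    *-⨾ {θ = θ} = ≃-trans (F-cong (≋-sym cograph-⨾) θ) (F-⨾ θ)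

    *-id : ∀ {Γ} {θ : Pred Γ} → (id *) θ ≃ θ
    *-id {θ = θ} = ≃-trans (F-cong (⊆-intro (λ p → graph-intro (flip (cograph-elim p)))
                                   , ⊆-intro (λ p → cograph-intro (flip (graph-elim p)))) θ) (F-id θ)
      where
      flip : ∀ {A B} {f g : A ⇒ B} → f ⨾ id ≈ g → g ⨾ id ≈ f
      flip p = Equiv.trans identityʳ (Equiv.trans (Equiv.sym p) identityʳ)

    unit! : ∀ {Γ Γ′} {f : Γ ⇒ Γ′} {θ} → θ ⊢ (f *) ((f !) θ)
    unit! {θ = θ} = ⊢-trans (≃⇒⊢ (≃-sym (F-id θ)))
      (⊢-trans (F-mono id⊆graph⨟cograph θ) (≃⇒⊢ (F-⨾ θ)))

    counit! : ∀ {Γ Γ′} {f : Γ ⇒ Γ′} {θ} → (f !) ((f *) θ) ⊢ θ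
    counit! {θ = θ} = ⊢-trans (≃⇒⊢ (≃-sym (F-⨾ θ)))
      (⊢-trans (F-mono cograph⨟graph⊆id θ) (≃⇒⊢ (F-id θ)))

    !⇒* : ∀ {Γ Γ′} {f : Γ ⇒ Γ′} {θ χ} → (f !) θ ⊢ χ → θ ⊢ (f *) χ
    !⇒* p = ⊢-trans unit! (*-mono p)

    *⇒! : ∀ {Γ Γ′} {f : Γ ⇒ Γ′} {θ χ} → θ ⊢ (f *) χ → (f !) θ ⊢ χ
    *⇒! p = ⊢-trans (!-mono p) counit!

    !*-swap : ∀ {A B C} {f : A ⇒ C} {g : B ⇒ C} (S : Pullback f g) {θ} → let open Pullback S in
              (g *) ((f !) θ) ⊢ (p₂ !) ((p₁ *) θ)
    !*-swap S {θ} = ⊢-trans (≃⇒⊢ (≃-sym (F-⨾ θ)))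
      (⊢-trans (F-mono (proj₁ (beckChevalley S)) θ) (≃⇒⊢ (F-⨾ θ)))

    ⊠-! : ∀ {A B C D} {f : A ⇒ C} {g : B ⇒ D} {θ θ′} →
          (f !) θ ⊠ (g !) θ′ ≃ ((f ×₁ g) !) (θ ⊠ θ′)
    ⊠-! {θ = θ} {θ′} = ≃-trans (ρ-natural (θ , θ′)) (F-cong graph-⊗ (θ ⊠ θ′))

    ⊠-* : ∀ {A B C D} {f : A ⇒ C} {g : B ⇒ D} {θ θ′} →
          (f *) θ ⊠ (g *) θ′ ≃ ((f ×₁ g) *) (θ ⊠ θ′)
    ⊠-* {θ = θ} {θ′} = ≃-trans (ρ-natural (θ , θ′)) (F-cong cograph-⊗ (θ ⊠ θ′))

    true : ∀ {Γ} → Pred Γ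
    true = (bang *) (⟦ ρ₀ ⟧ tt)

    true-max : ∀ {Γ} {θ : Pred Γ} → θ ⊢ true
    true-max {θ = θ} = !⇒* (proj₁ (proj₂ ρ₀-rightAdjoint) _)

    ⊠-true : ∀ {Γ Γ′} {θ : Pred Γ} → θ ⊠ true {Γ′} ≃ (π₁ *) θ
    ⊠-true {Γ} {Γ′} {θ} = ⊢-antisym
      (⊢-trans (⊠-mono (≃⇒⊢ (≃-sym *-id)) ⊢-refl) (⊢-trans (≃⇒⊢ ⊠-*)
        (⊢-trans (*-mono (!⇒* (≃⇒⊢ (ρ-unitʳ (θ , tt)))))
          (⊢-trans (≃⇒⊢ (≃-sym *-⨾)) (*-cong lem₁)))))
      (⊢-trans (*-cong (Equiv.sym lem₁)) (⊢-trans (≃⇒⊢ *-⨾) (⊢-trans (*-mono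
        (⊢-trans (*-mono (⊢-trans (≃⇒⊢ (≃-sym (ρ-unitʳ (θ , tt))))
            (*⇒! {f = π₁} (⊢-trans (≃⇒⊢ (≃-sym *-id)) (⊢-trans (*-cong lem₂) (≃⇒⊢ *-⨾))))))
          (⊢-trans (≃⇒⊢ (≃-sym *-⨾)) (⊢-trans (*-cong (Equiv.sym lem₂)) (≃⇒⊢ *-id)))))
        (⊢-trans (≃⇒⊢ (≃-sym ⊠-*)) (⊠-mono (≃⇒⊢ *-id) ⊢-refl)))))
      where
      lem₁ : (id ×₁ bang) ⨾ π₁ {Γ} {⊤} ≈ π₁ {Γ} {Γ′}
      lem₁ = Equiv.trans project₁ identityʳ
      lem₂ : id {Γ × ⊤} ≈ π₁ ⨾ ⟨ id , bang ⟩
      lem₂ = ext (Equiv.trans identityˡ (Equiv.sym (Equiv.trans (pullʳ project₁) identityʳ))) !-unique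

    true-⊠ : ∀ {Γ Γ′} {θ : Pred Γ} → true {Γ′} ⊠ θ ≃ (π₂ *) θ
    true-⊠ {Γ} {Γ′} {θ} = ⊢-antisym
      (⊢-trans (⊠-mono ⊢-refl (≃⇒⊢ (≃-sym *-id))) (⊢-trans (≃⇒⊢ ⊠-*)
        (⊢-trans (*-mono (!⇒* (≃⇒⊢ (ρ-unitˡ (tt , θ)))))
          (⊢-trans (≃⇒⊢ (≃-sym *-⨾)) (*-cong lem₁)))))
      (⊢-trans (*-cong (Equiv.sym lem₁)) (⊢-trans (≃⇒⊢ *-⨾) (⊢-trans (*-mono
        (⊢-trans (*-mono (⊢-trans (≃⇒⊢ (≃-sym (ρ-unitˡ (tt , θ))))
            (*⇒! {f = π₂} (⊢-trans (≃⇒⊢ (≃-sym *-id)) (⊢-trans (*-cong lem₂) (≃⇒⊢ *-⨾))))))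
          (⊢-trans (≃⇒⊢ (≃-sym *-⨾)) (⊢-trans (*-cong (Equiv.sym lem₂)) (≃⇒⊢ *-id)))))
        (⊢-trans (≃⇒⊢ (≃-sym ⊠-*)) (⊠-mono ⊢-refl (≃⇒⊢ *-id))))))
      where
      lem₁ : (bang ×₁ id) ⨾ π₂ {⊤} {Γ} ≈ π₂ {Γ′} {Γ}
      lem₁ = Equiv.trans project₂ identityʳ
      lem₂ : id {⊤ × Γ} ≈ π₂ ⨾ ⟨ bang , id ⟩
      lem₂ = ext !-unique (Equiv.trans identityˡ (Equiv.sym (Equiv.trans (pullʳ project₂) identityʳ)))

    -- θ ⊠ θ′ is the meet of (π₁ *) θ and (π₂ *) θ′.
    ⊠-lower₁ : ∀ {Γ Γ′} {θ : Pred Γ} {θ′ : Pred Γ′} → θ ⊠ θ′ ⊢ (π₁ *) θ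
    ⊠-lower₁ = ⊢-trans (⊠-mono ⊢-refl true-max) (≃⇒⊢ ⊠-true)

    ⊠-lower₂ : ∀ {Γ Γ′} {θ : Pred Γ} {θ′ : Pred Γ′} → θ ⊠ θ′ ⊢ (π₂ *) θ′
    ⊠-lower₂ = ⊢-trans (⊠-mono true-max ⊢-refl) (≃⇒⊢ true-⊠)

    ⊠-greatest : ∀ {Γ Γ′} {θ : Pred Γ} {θ′ : Pred Γ′} {ψ} →
                 ψ ⊢ (π₁ *) θ → ψ ⊢ (π₂ *) θ′ → ψ ⊢ θ ⊠ θ′
    ⊠-greatest {Γ} {Γ′} {θ} {θ′} {ψ} p q = ⊢-trans (unit ψ) (⊠-mono
        (⊢-trans (proj₁ (mono (⊢-trans p (≃⇒⊢ (≃-sym ⊠-true))))) (proj₁ (counit (θ , true))))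
        (⊢-trans (proj₂ (mono (⊢-trans q (≃⇒⊢ (≃-sym true-⊠))))) (proj₂ (counit (true , θ′)))))
      where
      unit = proj₁ (proj₂ (ρ-rightAdjoint {Γ} {Γ′}))
      counit = proj₂ (proj₂ (ρ-rightAdjoint {Γ} {Γ′}))
      mono = PosetHomomorphism.mono (proj₁ (ρ-rightAdjoint {Γ} {Γ′}))

    -- ψ ⊢ θ [ x ] reads: in context Δ and under hypothesis ψ, θ holds of x.
    infix 4 _⊢_[_]
    _⊢_[_] : ∀ {Δ Γ} → Pred Δ → Pred Γ → Δ ⇒ Γ → Set ℓ₂
    ψ ⊢ θ [ x ] = ψ ⊢ (x *) θ

    at-cong : ∀ {Δ Γ} {ψ : Pred Δ} {θ : Pred Γ} {x y : Δ ⇒ Γ} → x ≈ y → ψ ⊢ θ [ x ] → ψ ⊢ θ [ y ]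
    at-cong p q = ⊢-trans q (*-cong p)

    at-mono : ∀ {Δ Γ} {ψ : Pred Δ} {θ χ : Pred Γ} {x : Δ ⇒ Γ} → θ ⊢ χ → ψ ⊢ θ [ x ] → ψ ⊢ χ [ x ]
    at-mono p q = ⊢-trans q (*-mono p)

    at-⨾ : ∀ {Δ Γ Γ′} {ψ : Pred Δ} {θ : Pred Γ′} {x : Δ ⇒ Γ} {f : Γ ⇒ Γ′} →
           ψ ⊢ (f *) θ [ x ] → ψ ⊢ θ [ x ⨾ f ]
    at-⨾ p = ⊢-trans p (≃⇒⊢ (≃-sym *-⨾))

    at-⨾⁻¹ : ∀ {Δ Γ Γ′} {ψ : Pred Δ} {θ : Pred Γ′} {x : Δ ⇒ Γ} {f : Γ ⇒ Γ′} →
             ψ ⊢ θ [ x ⨾ f ] → ψ ⊢ (f *) θ [ x ]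
    at-⨾⁻¹ p = ⊢-trans p (≃⇒⊢ *-⨾)

    at-id : ∀ {Γ} {ψ θ : Pred Γ} → ψ ⊢ θ → ψ ⊢ θ [ id ]
    at-id p = ⊢-trans p (≃⇒⊢ (≃-sym *-id))

    at-id⁻¹ : ∀ {Γ} {ψ θ : Pred Γ} → ψ ⊢ θ [ id ] → ψ ⊢ θ
    at-id⁻¹ p = ⊢-trans p (≃⇒⊢ *-id)

    reindex : ∀ {E Δ Γ} {ω : Pred E} {ψ : Pred Δ} {θ : Pred Γ} {p : E ⇒ Δ} {x : Δ ⇒ Γ} →
              ω ⊢ ψ [ p ] → ψ ⊢ θ [ x ] → ω ⊢ θ [ p ⨾ x ]
    reindex p q = at-⨾ (at-mono q p)

    ⊠-intro : ∀ {Δ Γ Γ′} {ψ : Pred Δ} {θ : Pred Γ} {θ′ : Pred Γ′} {x y} →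
              ψ ⊢ θ [ x ] → ψ ⊢ θ′ [ y ] → ψ ⊢ θ ⊠ θ′ [ ⟨ x , y ⟩ ]
    ⊠-intro p q = !⇒* (⊠-greatest
      (*⇒! (at-⨾⁻¹ (at-cong (Equiv.sym project₁) p)))
      (*⇒! (at-⨾⁻¹ (at-cong (Equiv.sym project₂) q))))

    ⊠-elim₁ : ∀ {Δ Γ Γ′} {ψ : Pred Δ} {θ : Pred Γ} {θ′ : Pred Γ′} {x} →
              ψ ⊢ θ ⊠ θ′ [ x ] → ψ ⊢ θ [ x ⨾ π₁ ]
    ⊠-elim₁ p = at-⨾ (at-mono ⊠-lower₁ p)

    ⊠-elim₂ : ∀ {Δ Γ Γ′} {ψ : Pred Δ} {θ : Pred Γ} {θ′ : Pred Γ′} {x} →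
              ψ ⊢ θ ⊠ θ′ [ x ] → ψ ⊢ θ′ [ x ⨾ π₂ ]
    ⊠-elim₂ p = at-⨾ (at-mono ⊠-lower₂ p)

    infixr 7 _⊓_
    _⊓_ : ∀ {Γ} → Pred Γ → Pred Γ → Pred Γ
    θ ⊓ χ = (δ *) (θ ⊠ χ)

    ⊓-lower₁ : ∀ {Γ} {θ χ : Pred Γ} → θ ⊓ χ ⊢ θ
    ⊓-lower₁ = at-id⁻¹ (at-cong project₁ (⊠-elim₁ ⊢-refl))

    ⊓-lower₂ : ∀ {Γ} {θ χ : Pred Γ} → θ ⊓ χ ⊢ χ
    ⊓-lower₂ = at-id⁻¹ (at-cong project₂ (⊠-elim₂ ⊢-refl))

    ⊓-greatest : ∀ {Γ} {θ χ ψ : Pred Γ} → ψ ⊢ θ → ψ ⊢ χ → ψ ⊢ θ ⊓ χ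
    ⊓-greatest p q = ⊠-intro (at-id p) (at-id q)

    frobenius : ∀ {Γ Γ′} {f : Γ ⇒ Γ′} {θ χ} → (f !) θ ⊓ χ ⊢ (f !) (θ ⊓ (f *) χ)
    frobenius {Γ} {Γ′} {f} {θ} {χ} =
      ⊢-trans (*-mono (⊢-trans (⊠-mono ⊢-refl id!) (≃⇒⊢ ⊠-!)))
        (⊢-trans (!*-swap square) (!-mono (⊓-greatest
          (at-id⁻¹ (at-cong project₁ (⊠-elim₁ ⊢-refl)))
          (at-cong project₂ (⊠-elim₂ ⊢-refl)))))
      where
      id! : χ ⊢ (id !) χ
      id! = ≃⇒⊢ (≃-sym (F-id χ))
      square : Pullback (f ×₁ id) δ
      square = record
        { p₁ = ⟨ id , f ⟩ ; p₂ = f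
        ; isPullback = record
          { commute = Equiv.trans ⟨⟩×₁ (Equiv.trans (⟨⟩-cong identityˡ identityʳ) (Equiv.sym ⨾δ))
          ; universal = λ {_} {x} _ → x ⨾ π₁
          ; factors₁ = λ {_} {x} {y} s → Equiv.trans ⨾⟨⟩ (Equiv.sym
              (⟨⟩-unique (Equiv.sym identityʳ)
                (Equiv.trans (x₂ s) (Equiv.sym (x₁ s)))))
          ; factors₂ = x₁
          ; unique = λ {_} {x} p q → Equiv.trans (Equiv.sym identityʳ)
              (Equiv.trans (⨾-congˡ (Equiv.sym project₁)) (pullˡ p))
          }
        }
        where
        x₁ : ∀ {X} {x : X ⇒ Γ × Γ′} {y} → x ⨾ (f ×₁ id) ≈ y ⨾ δ → (x ⨾ π₁) ⨾ f ≈ y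
        x₁ s = Equiv.trans (pullʳ (Equiv.sym project₁)) (Equiv.trans (pullˡ s)
                 (Equiv.trans (pullʳ project₁) identityʳ))
        x₂ : ∀ {X} {x : X ⇒ Γ × Γ′} {y} → x ⨾ (f ×₁ id) ≈ y ⨾ δ → x ⨾ π₂ ≈ y
        x₂ s = Equiv.trans (⨾-congˡ (Equiv.trans (Equiv.sym identityʳ) (Equiv.sym project₂)))
                 (Equiv.trans (pullˡ s) (Equiv.trans (pullʳ project₂) identityʳ))

    !-intro : ∀ {Δ Γ Γ′} {f : Γ ⇒ Γ′} {ψ : Pred Δ} {θ x} →
              ψ ⊢ θ [ x ] → ψ ⊢ (f !) θ [ x ⨾ f ]
    !-intro p = reindex p unit!

    !-elim : ∀ {Δ Γ Γ′} {f : Γ ⇒ Γ′} {ψ χ : Pred Δ} {θ x} → ψ ⊢ (f !) θ [ x ] →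
             (∀ {E} {p : E ⇒ Δ} {y : E ⇒ Γ} {ω : Pred E} →
                y ⨾ f ≈ p ⨾ x → ω ⊢ ψ [ p ] → ω ⊢ θ [ y ] → ω ⊢ χ [ p ]) →
             ψ ⊢ χ
    !-elim {f = f} {x = x} p k =
      ⊢-trans (⊓-greatest (⊢-trans p (!*-swap S)) ⊢-refl)
        (⊢-trans frobenius (*⇒! (k S.commute ⊓-lower₂ ⊓-lower₁)))
      where
      S = pullback f x
      module S = Pullback S

    ⨟ᵢ-intro : ∀ {Δ Γ₁ Γ₂ Γ₃} {ψ : Pred Δ} {θ : Pred (Γ₁ × Γ₂)} {θ′ : Pred (Γ₂ × Γ₃)} {x y z} →
               ψ ⊢ θ [ ⟨ x , y ⟩ ] → ψ ⊢ θ′ [ ⟨ y , z ⟩ ] → ψ ⊢ θ ⨟ᵢ θ′ [ ⟨ x , z ⟩ ]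
    ⨟ᵢ-intro {x = x} {y} {z} p q = at-cong
      (Equiv.trans ⨾⟨⟩ (⟨⟩-cong project₁ (Equiv.trans (pullˡ project₂) project₂)))
      (!-intro (at-⨾⁻¹ {x = ⟨ x , ⟨ y , z ⟩ ⟩} (at-cong (Equiv.sym (Equiv.trans ⨾⟨⟩ (⟨⟩-cong
          (Equiv.trans ⨾⟨⟩ (⟨⟩-cong project₁ (Equiv.trans (pullˡ project₂) project₁)))
          project₂))) (⊠-intro p q))))

    ⨟ᵢ-elim : ∀ {Δ Γ₁ Γ₂ Γ₃} {ψ χ : Pred Δ} {θ : Pred (Γ₁ × Γ₂)} {θ′ : Pred (Γ₂ × Γ₃)} {x z} →
              ψ ⊢ θ ⨟ᵢ θ′ [ ⟨ x , z ⟩ ] →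
              (∀ {E} {p : E ⇒ Δ} {y : E ⇒ Γ₂} {ω : Pred E} → ω ⊢ ψ [ p ] →
                 ω ⊢ θ [ ⟨ p ⨾ x , y ⟩ ] → ω ⊢ θ′ [ ⟨ y , p ⨾ z ⟩ ] → ω ⊢ χ [ p ]) →
              ψ ⊢ χ
    ⨟ᵢ-elim {x = x} {z} h k = !-elim h λ {_} {p} {w} s a b →
      k {y = w ⨾ π₂ ⨾ π₁} a
        (at-cong (Equiv.trans (pullʳ project₁) (Equiv.trans ⨾⟨⟩ (⟨⟩-cong (w₁ s) Equiv.refl)))
          (⊠-elim₁ (at-⨾ b)))
        (at-cong (Equiv.trans (pullʳ project₂) (ext
            (Equiv.trans assoc (Equiv.sym project₁))
            (Equiv.trans assoc (Equiv.trans (w₃ s) (Equiv.sym project₂)))))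
          (⊠-elim₂ (at-⨾ b)))
      where
      w₁ : ∀ {E} {w : E ⇒ _} {p : E ⇒ _} → w ⨾ π₁₃ ≈ p ⨾ ⟨ x , z ⟩ → w ⨾ π₁ ≈ p ⨾ x
      w₁ s = Equiv.trans (⨾-congˡ (Equiv.sym project₁)) (Equiv.trans (pullˡ s) (pullʳ project₁))
      w₃ : ∀ {E} {w : E ⇒ _} {p : E ⇒ _} → w ⨾ π₁₃ ≈ p ⨾ ⟨ x , z ⟩ → w ⨾ π₂ ⨾ π₂ ≈ p ⨾ z
      w₃ s = Equiv.trans (⨾-congˡ (Equiv.sym project₂)) (Equiv.trans (pullˡ s) (pullʳ project₂))

    idᵢ-intro : ∀ {Δ Γ} {ψ : Pred Δ} {φ : Pred Γ} {x y} →
                x ≈ y → ψ ⊢ φ [ x ] → ψ ⊢ idᵢ φ [ ⟨ x , y ⟩ ]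
    idᵢ-intro p q = at-cong (Equiv.trans ⨾δ (⟨⟩-cong Equiv.refl p)) (!-intro q)

    idᵢ-elim : ∀ {Δ Γ} {ψ χ : Pred Δ} {φ : Pred Γ} {x y} → ψ ⊢ idᵢ φ [ ⟨ x , y ⟩ ] →
               (∀ {E} {p : E ⇒ Δ} {ω : Pred E} → p ⨾ x ≈ p ⨾ y → ω ⊢ ψ [ p ] →
                  ω ⊢ φ [ p ⨾ x ] → ω ⊢ χ [ p ]) →
               ψ ⊢ χ
    idᵢ-elim {x = x} {y} h k = !-elim h λ {_} {p} {w} s a b →
      let u = Equiv.trans (⨾-congˡ (Equiv.sym project₁)) (Equiv.trans (pullˡ s) (pullʳ project₁))
          v = Equiv.trans (⨾-congˡ (Equiv.sym project₂)) (Equiv.trans (pullˡ s) (pullʳ project₂))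
      in k (Equiv.trans (Equiv.sym u) v) a (at-cong (Equiv.trans (Equiv.sym identityʳ) u) b)

    ⊢-ext : ∀ {Γ₁ Γ₂} {θ θ′ : Pred (Γ₁ × Γ₂)} →
            (∀ {Δ} {ψ : Pred Δ} {x : Δ ⇒ Γ₁} {y : Δ ⇒ Γ₂} →
               ψ ⊢ θ [ ⟨ x , y ⟩ ] → ψ ⊢ θ′ [ ⟨ x , y ⟩ ]) → θ ⊢ θ′
    ⊢-ext {θ = θ} {θ′} k = at-id⁻¹ (at-cong tup (k (at-cong (Equiv.sym tup) (at-id ⊢-refl))))
      where
      tup : ∀ {A B} → ⟨ π₁ {A} {B} , π₂ ⟩ ≈ id
      tup = Equiv.sym (⟨⟩-unique identityˡ identityˡ)

    supported : ∀ {Γ₁ Γ₂} {φ₁ : Pred Γ₁} {φ₂ : Pred Γ₂} {θ : Pred (Γ₁ × Γ₂)} →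
                (∀ {Δ} {ψ : Pred Δ} {x : Δ ⇒ Γ₁} {y : Δ ⇒ Γ₂} →
                   ψ ⊢ θ [ ⟨ x , y ⟩ ] → ψ ⊢ φ₁ [ x ] ∧ ψ ⊢ φ₂ [ y ]) → Supported φ₁ φ₂ θ
    supported k = let p , q = k (at-cong η (at-id ⊢-refl)) in
      *⇒! (at-cong identityˡ p) , *⇒! (at-cong identityˡ q)

    support₁ : ∀ {Δ Γ₁ Γ₂} {φ₁ : Pred Γ₁} {φ₂ : Pred Γ₂} {θ : Pred (Γ₁ × Γ₂)} {ψ : Pred Δ} {x y} →
               Supported φ₁ φ₂ θ → ψ ⊢ θ [ ⟨ x , y ⟩ ] → ψ ⊢ φ₁ [ x ]
    support₁ (s , _) p = at-cong project₁ (reindex p (!⇒* s))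

    support₂ : ∀ {Δ Γ₁ Γ₂} {φ₁ : Pred Γ₁} {φ₂ : Pred Γ₂} {θ : Pred (Γ₁ × Γ₂)} {ψ : Pred Δ} {x y} →
               Supported φ₁ φ₂ θ → ψ ⊢ θ [ ⟨ x , y ⟩ ] → ψ ⊢ φ₂ [ y ]
    support₂ (_ , s) p = at-cong project₂ (reindex p (!⇒* s))

    reindex₂ : ∀ {E Δ Γ₁ Γ₂} {ω : Pred E} {ψ : Pred Δ} {θ : Pred (Γ₁ × Γ₂)} {p : E ⇒ Δ} {x y} →
               ω ⊢ ψ [ p ] → ψ ⊢ θ [ ⟨ x , y ⟩ ] → ω ⊢ θ [ ⟨ p ⨾ x , p ⨾ y ⟩ ]
    reindex₂ p q = at-cong ⨾⟨⟩ (reindex p q)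

    at-pair : ∀ {E Δ Γ₁ Γ₂} {ω : Pred E} {θ : Pred (Γ₁ × Γ₂)} {p : E ⇒ Δ} {x y} →
              ω ⊢ θ [ ⟨ p ⨾ x , p ⨾ y ⟩ ] → ω ⊢ (⟨ x , y ⟩ *) θ [ p ]
    at-pair p = at-⨾⁻¹ (at-cong (Equiv.sym ⨾⟨⟩) p)

  open Logic

  private
    ⨟ᵢ-mono : ∀ {A B C} {θ χ : Pred (A × B)} {θ′ χ′ : Pred (B × C)} →
              θ ⊢ χ → θ′ ⊢ χ′ → θ ⨟ᵢ θ′ ⊢ χ ⨟ᵢ χ′
    ⨟ᵢ-mono p q = !-mono (*-mono (⊠-mono p q))

    id-supported : ∀ {Γ} {φ : Pred Γ} → Supported φ φ (idᵢ φ)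
    id-supported = supported λ h →
        idᵢ-elim h (λ _ _ b → at-⨾⁻¹ b) , idᵢ-elim h (λ s _ b → at-⨾⁻¹ (at-cong s b))

    ⨟ᵢ-supported : ∀ {A B C} {φ₁ : Pred A} {φ₂ : Pred B} {φ₃ : Pred C} {θ θ′} →
                   Supported φ₁ φ₂ θ → Supported φ₂ φ₃ θ′ → Supported φ₁ φ₃ (θ ⨟ᵢ θ′)
    ⨟ᵢ-supported s t = supported λ h →
        ⨟ᵢ-elim h (λ _ a _ → at-⨾⁻¹ (support₁ s a)) , ⨟ᵢ-elim h (λ _ _ b → at-⨾⁻¹ (support₂ t b))

    ⨟ᵢ-identityˡ : ∀ {A B} {φ₁ : Pred A} {φ₂ : Pred B} {θ} →
                   Supported φ₁ φ₂ θ → idᵢ φ₁ ⨟ᵢ θ ≃ θ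
    ⨟ᵢ-identityˡ s = ⊢-antisym
      (⊢-ext λ h → ⨟ᵢ-elim h λ _ a b → at-pair (idᵢ-elim a λ p c _ →
         at-pair (at-cong (⟨⟩-cong (Equiv.sym p) Equiv.refl) (reindex₂ c b))))
      (⊢-ext λ h → ⨟ᵢ-intro (idᵢ-intro Equiv.refl (support₁ s h)) h)

    ⨟ᵢ-identityʳ : ∀ {A B} {φ₁ : Pred A} {φ₂ : Pred B} {θ} →
                   Supported φ₁ φ₂ θ → θ ⨟ᵢ idᵢ φ₂ ≃ θ
    ⨟ᵢ-identityʳ s = ⊢-antisym
      (⊢-ext λ h → ⨟ᵢ-elim h λ _ a b → at-pair (idᵢ-elim b λ p c _ →
         at-pair (at-cong (⟨⟩-cong Equiv.refl p) (reindex₂ c a))))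
      (⊢-ext λ h → ⨟ᵢ-intro h (idᵢ-intro Equiv.refl (support₂ s h)))

    ⨟ᵢ-assoc : ∀ {A B C D} {θ : Pred (A × B)} {θ′ : Pred (B × C)} {θ″ : Pred (C × D)} →
               (θ ⨟ᵢ θ′) ⨟ᵢ θ″ ≃ θ ⨟ᵢ (θ′ ⨟ᵢ θ″)
    ⨟ᵢ-assoc = ⊢-antisym
      (⊢-ext λ h → ⨟ᵢ-elim h λ _ a b → at-pair (⨟ᵢ-elim a λ c d f →
         at-pair (⨟ᵢ-intro d (⨟ᵢ-intro f (reindex₂ c b)))))
      (⊢-ext λ h → ⨟ᵢ-elim h λ _ a b → at-pair (⨟ᵢ-elim b λ c d f →
         at-pair (⨟ᵢ-intro (⨟ᵢ-intro (reindex₂ c a) d) f)))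

  IntRel : PoCategory (o ⊔ c) (c ⊔ ℓ₂) ℓ₁ ℓ₂
  IntRel = record
    { Obj       = Σ Obj Pred
    ; Hom       = λ (Γ₁ , φ₁) (Γ₂ , φ₂) →
                    On.poset (F₀ (Γ₁ × Γ₂)) (proj₁ {B = Supported φ₁ φ₂})
    ; id        = λ { {_ , φ} → idᵢ φ , id-supported }
    ; _⨾_       = λ (θ , s) (θ′ , s′) → θ ⨟ᵢ θ′ , ⨟ᵢ-supported s s′
    ; ⨾-mono    = ⨟ᵢ-mono
    ; identityˡ = λ { {f = _ , s} → ⨟ᵢ-identityˡ s }
    ; identityʳ = λ { {f = _ , s} → ⨟ᵢ-identityʳ s }
    ; assoc     = ⨟ᵢ-assoc
    }

record RegularCalculus t c ℓ₁ ℓ₂ : Set (suc (t ⊔ c ⊔ ℓ₁ ⊔ ℓ₂)) where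
  field
    T : Set t
    P : AjaxPoFunctor (𝔽Rg T) (POSET c ℓ₁ ℓ₂)

𝕀ntRel : ∀ {t c ℓ₁ ℓ₂} → RegularCalculus t c ℓ₁ ℓ₂ → PoCategory (t ⊔ c) (c ⊔ ℓ₂) ℓ₁ ℓ₂
𝕀ntRel 𝒫 = InternalRelations.IntRel (FRg T) P
  where open RegularCalculus 𝒫

InternalFunctions : ∀ {t c ℓ₁ ℓ₂} → RegularCalculus t c ℓ₁ ℓ₂ → Category (t ⊔ c) (c ⊔ ℓ₂) ℓ₁
InternalFunctions 𝒫 = LAdj (𝕀ntRel 𝒫)

{-# OPTIONS --safe #-}
module Submission where

open import Defs
open import Data.Product using (_,_; proj₁; proj₂)
open import Level using (_⊔_)
open import Relation.Binary using (Poset)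
import Relation.Binary.Reasoning.PartialOrder as PosetReasoning

-- The po-category of internal relations is a unitary tabular allegory: the
-- internal regular logic provides converses, meets, the modular law and, by
-- comprehension, the tabulation of θ ∈ P(Γ₁ ⊕ Γ₂) by the object (Γ₁ ⊕ Γ₂ , θ).
-- In such an allegory the left adjoints are the maps, that is the f with f ⊣ f °,
-- and they form a regular category: all finite limits are tabulations, and a map
-- e is a regular epimorphism iff id ≤ e ° ⨾ e.

-- Allegories with a unit and tabulations.

module _ {o c ℓ₁ ℓ₂} (𝒞 : PoCategory o c ℓ₁ ℓ₂) where
  open PoCategory 𝒞

  record Allegory : Set (o ⊔ c ⊔ ℓ₁ ⊔ ℓ₂) where
    infix  11 _°
    infixr 7 _⊓_
    field
      _°           : ∀ {A B} → A ⇒ B → B ⇒ A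
      °-mono       : ∀ {A B} {R S : A ⇒ B} → R ≤ S → R ° ≤ S °
      °-involutive : ∀ {A B} {R : A ⇒ B} → R ° ° ≈ R
      °-⨾          : ∀ {A B C} {R : A ⇒ B} {S : B ⇒ C} → (R ⨾ S) ° ≈ S ° ⨾ R °

      _⊓_        : ∀ {A B} → A ⇒ B → A ⇒ B → A ⇒ B
      ⊓-lower₁   : ∀ {A B} {R S : A ⇒ B} → R ⊓ S ≤ R
      ⊓-lower₂   : ∀ {A B} {R S : A ⇒ B} → R ⊓ S ≤ S
      ⊓-greatest : ∀ {A B} {Q R S : A ⇒ B} → Q ≤ R → Q ≤ S → Q ≤ R ⊓ S

      modular : ∀ {A B C} {R : A ⇒ B} {S : B ⇒ C} {T : A ⇒ C} →
                (R ⨾ S) ⊓ T ≤ R ⨾ (S ⊓ (R ° ⨾ T))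

    -- `tab` presents R as the relation of a span of maps, and `jointly` is joint injectivity in
    -- relational form: two points with the same image under both legs coincide.
    record Tabulation {A B} (R : A ⇒ B) : Set (o ⊔ c ⊔ ℓ₁ ⊔ ℓ₂) where
      field
        {∣R∣}   : Obj
        p₁      : ∣R∣ ⇒ A
        p₂      : ∣R∣ ⇒ B
        p₁-map  : p₁ ⊣ p₁ °
        p₂-map  : p₂ ⊣ p₂ °
        tab     : p₁ ° ⨾ p₂ ≈ R
        jointly : (p₁ ⨾ p₁ °) ⊓ (p₂ ⨾ p₂ °) ≤ id

  record UnitaryTabular (𝒜 : Allegory) : Set (o ⊔ c ⊔ ℓ₁ ⊔ ℓ₂) where
    open Allegory 𝒜
    field
      top        : ∀ {A B} → A ⇒ B
      top-max    : ∀ {A B} {R : A ⇒ B} → R ≤ top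
      unit       : Obj
      top-unit   : top ≤ id {unit}
      unit-total : ∀ {A} → id {A} ≤ top {A} {unit} ⨾ top
      tabulate   : ∀ {A B} (R : A ⇒ B) → Tabulation R

-- Adjunctions and the modular law in an allegory.

module MapsOf {o c ℓ₁ ℓ₂} {𝒞 : PoCategory o c ℓ₁ ℓ₂} (𝒜 : Allegory 𝒞) where
  open PoCategory 𝒞
  open Allegory 𝒜
  private
    module ≈ {A B} = Poset.Eq (Hom A B)
    module Reasoning {A B} = PosetReasoning (Hom A B)
  open Homs using (refl; trans; reflexive)
  open Reasoning

  private variable
    A B C D X : Obj

  ⨾-monoˡ : {R : A ⇒ B} {S S′ : B ⇒ C} → S ≤ S′ → R ⨾ S ≤ R ⨾ S′
  ⨾-monoˡ = ⨾-mono refl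

  ⨾-monoʳ : {R R′ : A ⇒ B} {S : B ⇒ C} → R ≤ R′ → R ⨾ S ≤ R′ ⨾ S
  ⨾-monoʳ p = ⨾-mono p refl

  module _ {f : A ⇒ B} {g : B ⇒ A} (adj : f ⊣ g) where
    private
      η = proj₁ adj
      ε = proj₂ adj

    shiftˡ : {R : A ⇒ C} {S : B ⇒ C} → g ⨾ R ≤ S → R ≤ f ⨾ S
    shiftˡ {R = R} {S} p = begin
      R            ≈⟨ identityˡ ⟨
      id ⨾ R       ≤⟨ ⨾-monoʳ η ⟩
      (f ⨾ g) ⨾ R  ≈⟨ assoc ⟩
      f ⨾ (g ⨾ R)  ≤⟨ ⨾-monoˡ p ⟩
      f ⨾ S        ∎

    unshiftˡ : {R : A ⇒ C} {S : B ⇒ C} → R ≤ f ⨾ S → g ⨾ R ≤ S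
    unshiftˡ {R = R} {S} p = begin
      g ⨾ R        ≤⟨ ⨾-monoˡ p ⟩
      g ⨾ (f ⨾ S)  ≈⟨ assoc ⟨
      (g ⨾ f) ⨾ S  ≤⟨ ⨾-monoʳ ε ⟩
      id ⨾ S       ≈⟨ identityˡ ⟩
      S            ∎

    shiftʳ : {R : C ⇒ A} {S : C ⇒ B} → R ⨾ f ≤ S → R ≤ S ⨾ g
    shiftʳ {R = R} {S} p = begin
      R            ≈⟨ identityʳ ⟨
      R ⨾ id       ≤⟨ ⨾-monoˡ η ⟩
      R ⨾ (f ⨾ g)  ≈⟨ assoc ⟨
      (R ⨾ f) ⨾ g  ≤⟨ ⨾-monoʳ p ⟩
      S ⨾ g        ∎

    unshiftʳ : {R : C ⇒ A} {S : C ⇒ B} → R ≤ S ⨾ g → R ⨾ f ≤ S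
    unshiftʳ {R = R} {S} p = begin
      R ⨾ f        ≤⟨ ⨾-monoʳ p ⟩
      (S ⨾ g) ⨾ f  ≈⟨ assoc ⟩
      S ⨾ (g ⨾ f)  ≤⟨ ⨾-monoˡ ε ⟩
      S ⨾ id       ≈⟨ identityʳ ⟩
      S            ∎

  ⊓-mono : {R R′ S S′ : A ⇒ B} → R ≤ R′ → S ≤ S′ → R ⊓ S ≤ R′ ⊓ S′
  ⊓-mono p q = ⊓-greatest (trans ⊓-lower₁ p) (trans ⊓-lower₂ q)

  °-⊓ : {R S : A ⇒ B} → (R ⊓ S) ° ≤ R ° ⊓ S °
  °-⊓ = ⊓-greatest (°-mono ⊓-lower₁) (°-mono ⊓-lower₂)

  °-⨾-° : {R : A ⇒ B} {S : C ⇒ B} → (R ⨾ S °) ° ≈ S ⨾ R °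
  °-⨾-° = ≈.trans °-⨾ (⨾-cong °-involutive ≈.refl)

  °-°-⨾ : {R : B ⇒ A} {S : B ⇒ C} → (R ° ⨾ S) ° ≈ S ° ⨾ R
  °-°-⨾ = ≈.trans °-⨾ (⨾-cong ≈.refl °-involutive)

  modularʳ : {R : A ⇒ B} {S : B ⇒ C} {T : A ⇒ C} → (R ⨾ S) ⊓ T ≤ (R ⊓ (T ⨾ S °)) ⨾ S
  modularʳ {R = R} {S} {T} = begin
    (R ⨾ S) ⊓ T                          ≈⟨ °-involutive ⟨
    ((R ⨾ S) ⊓ T) ° °                    ≤⟨ °-mono °-⊓ ⟩
    ((R ⨾ S) ° ⊓ T °) °                  ≤⟨ °-mono (⊓-mono (reflexive °-⨾) refl) ⟩
    ((S ° ⨾ R °) ⊓ T °) °                ≤⟨ °-mono modular ⟩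
    (S ° ⨾ (R ° ⊓ (S ° ° ⨾ T °))) °      ≈⟨ °-°-⨾ ⟩
    (R ° ⊓ (S ° ° ⨾ T °)) ° ⨾ S          ≤⟨ ⨾-monoʳ °-⊓ ⟩
    (R ° ° ⊓ (S ° ° ⨾ T °) °) ⨾ S
      ≤⟨ ⨾-monoʳ (⊓-mono (reflexive °-involutive)
           (reflexive (≈.trans °-⨾-° (⨾-cong ≈.refl °-involutive)))) ⟩
    (R ⊓ (T ⨾ S °)) ⨾ S                  ∎

  -- Meeting `R ⨾ S` with `id` and applying the modular law trades the arbitrary S for `R °`.
  total : {R : A ⇒ B} {S : B ⇒ A} → id ≤ R ⨾ S → id ≤ R ⨾ R °
  total {R = R} {S} p = begin
    id                        ≤⟨ ⊓-greatest p refl ⟩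
    (R ⨾ S) ⊓ id              ≤⟨ modular ⟩
    R ⨾ (S ⊓ (R ° ⨾ id))      ≤⟨ ⨾-monoˡ ⊓-lower₂ ⟩
    R ⨾ (R ° ⨾ id)            ≈⟨ ⨾-cong ≈.refl identityʳ ⟩
    R ⨾ R °                   ∎

  cototal : {R : A ⇒ B} {S : B ⇒ A} → id ≤ R ⨾ S → id ≤ S ° ⨾ S
  cototal {R = R} {S} p = begin
    id                        ≤⟨ ⊓-greatest p refl ⟩
    (R ⨾ S) ⊓ id              ≤⟨ modularʳ ⟩
    (R ⊓ (id ⨾ S °)) ⨾ S      ≤⟨ ⨾-monoʳ ⊓-lower₂ ⟩
    (id ⨾ S °) ⨾ S            ≈⟨ ⨾-cong identityˡ ≈.refl ⟩
    S ° ⨾ S                   ∎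

  -- Transposing `id ≤ g ° ⨾ g` gives `f ≤ g °`, so `f °` lies below g and inherits its counit; the
  -- unit comes from `total`. Every morphism of `LAdj` can thus be handled through its converse.
  leftAdjoint⇒map : {f : A ⇒ B} {g : B ⇒ A} → f ⊣ g → f ⊣ f °
  leftAdjoint⇒map {f = f} {g} adj@(η , ε) = total η , (begin
    f ° ⨾ f  ≤⟨ ⨾-monoʳ f°≤g ⟩
    g ⨾ f    ≤⟨ ε ⟩
    id       ∎)
    where
    f≤g° : f ≤ g °
    f≤g° = trans (reflexive (≈.sym identityˡ)) (unshiftʳ adj (cototal η))
    f°≤g : f ° ≤ g
    f°≤g = trans (°-mono f≤g°) (reflexive °-involutive)

  -- From `id ≤ f ⨾ f ° ≤ f ⨾ g °`, transposition along g gives `g ≤ f`. One inequality therefore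
  -- suffices for every equation between maps below.
  maps-discrete : {f g : A ⇒ B} → f ⊣ f ° → g ⊣ g ° → f ≤ g → f ≈ g
  maps-discrete {f = f} {g} (η , _) g-map f≤g = Homs.antisym f≤g (begin
    g       ≈⟨ identityˡ ⟨
    id ⨾ g  ≤⟨ unshiftʳ g-map (trans η (⨾-monoˡ (°-mono f≤g))) ⟩
    f       ∎)

  -- The category of maps, with commuting squares as inequalities.

  Maps : Category o (c ⊔ ℓ₂) ℓ₁
  Maps = LAdj 𝒞
  open Category Maps using () renaming (_⇒_ to _⟶_; _≈_ to _≐_; _⨾_ to _∘_)

  map : {f : A ⇒ B} → f ⊣ f ° → A ⟶ B
  map {f = f} m = f , f ° , m

  isMap : (f : A ⟶ B) → proj₁ f ⊣ proj₁ f °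
  isMap (_ , _ , adj) = leftAdjoint⇒map adj

  ≤⇒≐ : (f g : A ⟶ B) → proj₁ f ≤ proj₁ g → f ≐ g
  ≤⇒≐ f g = maps-discrete (isMap f) (isMap g)

  °⨾-swap : {f : X ⇒ A} {g : X ⇒ B} {h : D ⇒ A} {k : D ⇒ B} →
            f ° ⨾ g ≤ h ° ⨾ k → g ° ⨾ f ≤ k ° ⨾ h
  °⨾-swap {f = f} {g} {h} {k} p = begin
    g ° ⨾ f      ≈⟨ °-°-⨾ ⟨
    (f ° ⨾ g) °  ≤⟨ °-mono p ⟩
    (h ° ⨾ k) °  ≈⟨ °-°-⨾ ⟩
    k ° ⨾ h      ∎

  -- Together with `≤⇒commute` this identifies cones over a cospan with pairs of maps bounded by
  -- `f ⨾ g °`, which is why tabulating that relation yields a pullback.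
  commute⇒≤ : {x : X ⇒ A} {y : X ⇒ B} {f : A ⇒ C} {g : B ⇒ C} → x ⊣ x ° → g ⊣ g ° →
              x ⨾ f ≈ y ⨾ g → x ° ⨾ y ≤ f ⨾ g °
  commute⇒≤ {x = x} {y} {f} {g} x-map g-map p = unshiftˡ x-map (begin
    y              ≤⟨ shiftʳ g-map (reflexive (≈.sym p)) ⟩
    (x ⨾ f) ⨾ g °  ≈⟨ assoc ⟩
    x ⨾ (f ⨾ g °)  ∎)

  ≤⇒commute : (x : X ⟶ A) (y : X ⟶ B) (f : A ⟶ C) (g : B ⟶ C) →
              proj₁ x ° ⨾ proj₁ y ≤ proj₁ f ⨾ proj₁ g ° → x ∘ f ≐ y ∘ g
  ≤⇒commute x y f g p = ≈.sym (≤⇒≐ (y ∘ g) (x ∘ f) (unshiftʳ (isMap g) (begin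
    proj₁ y                            ≤⟨ shiftˡ (isMap x) p ⟩
    proj₁ x ⨾ (proj₁ f ⨾ proj₁ g °)    ≈⟨ assoc ⟨
    (proj₁ x ⨾ proj₁ f) ⨾ proj₁ g °    ∎)))

  -- The universal property of a tabulation.

  module TabulationProperties {R : A ⇒ B} (T : Tabulation R) where
    open Tabulation T renaming (∣R∣ to E) public

    fst : E ⟶ A
    fst = map p₁-map

    snd : E ⟶ B
    snd = map p₂-map

    module _ (x : X ⟶ A) (y : X ⟶ B) (x°y≤R : proj₁ x ° ⨾ proj₁ y ≤ R) where
      private
        f = proj₁ x
        g = proj₁ y
        -- Relates a point of X to the points of E lying over both of its images; the modular law
        -- shows that such points exist.
        h : X ⇒ E
        h = (f ⨾ p₁ °) ⊓ (g ⨾ p₂ °)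

        f°g≤ : f ° ⨾ g ≤ p₁ ° ⨾ p₂
        f°g≤ = trans x°y≤R (reflexive (≈.sym tab))

        -- The bound on `f ° ⨾ g`, reversed and transposed along g, puts f below `(g ⨾ p₂ °) ⨾ p₁`;
        -- the modular law then draws `f ⨾ p₁ °` into the meet, producing h.
        h₁ : h ⨾ p₁ ≈ f
        h₁ = Homs.antisym (unshiftʳ p₁-map ⊓-lower₁) (begin
          f                                    ≤⟨ ⊓-greatest (shiftˡ (isMap y) (°⨾-swap f°g≤)) refl ⟩
          (g ⨾ (p₂ ° ⨾ p₁)) ⊓ f                ≤⟨ ⊓-mono (reflexive (≈.sym assoc)) refl ⟩
          ((g ⨾ p₂ °) ⨾ p₁) ⊓ f                ≤⟨ modularʳ ⟩
          ((g ⨾ p₂ °) ⊓ (f ⨾ p₁ °)) ⨾ p₁       ≤⟨ ⨾-monoʳ (⊓-greatest ⊓-lower₂ ⊓-lower₁) ⟩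
          h ⨾ p₁                               ∎)

        h₂ : h ⨾ p₂ ≈ g
        h₂ = Homs.antisym (unshiftʳ p₂-map ⊓-lower₂) (begin
          g                                    ≤⟨ ⊓-greatest (shiftˡ (isMap x) f°g≤) refl ⟩
          (f ⨾ (p₁ ° ⨾ p₂)) ⊓ g                ≤⟨ ⊓-mono (reflexive (≈.sym assoc)) refl ⟩
          ((f ⨾ p₁ °) ⨾ p₂) ⊓ g                ≤⟨ modularʳ ⟩
          h ⨾ p₂                               ∎)

        h-total : id ≤ h ⨾ h °
        h-total = total (begin
          id                  ≤⟨ proj₁ (isMap x) ⟩
          f ⨾ f °             ≈⟨ ⨾-cong h₁ ≈.refl ⟨
          (h ⨾ p₁) ⨾ f °      ≈⟨ assoc ⟩
          h ⨾ (p₁ ⨾ f °)      ∎)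

        -- Each half of the meet h bounds `h ° ⨾ h` by the kernel of one leg; `jointly` sends the
        -- meet of the two bounds below `id`, so h is single-valued.
        leg : {k : X ⇒ C} {p : E ⇒ C} → k ⊣ k ° → h ≤ k ⨾ p ° → h ° ⨾ h ≤ p ⨾ p °
        leg {k = k} {p} k-map q = begin
          h ° ⨾ h                 ≤⟨ ⨾-mono (°-mono q) q ⟩
          (k ⨾ p °) ° ⨾ (k ⨾ p °) ≈⟨ ⨾-cong °-⨾-° ≈.refl ⟩
          (p ⨾ k °) ⨾ (k ⨾ p °)   ≈⟨ assoc ⟩
          p ⨾ (k ° ⨾ (k ⨾ p °))   ≤⟨ ⨾-monoˡ (unshiftˡ k-map refl) ⟩
          p ⨾ p °                 ∎

      pair : X ⟶ E
      pair = map {f = h} (h-total , trans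
        (⊓-greatest (leg (isMap x) ⊓-lower₁) (leg (isMap y) ⊓-lower₂)) jointly)

      pair-fst : pair ∘ fst ≐ x
      pair-fst = h₁

      pair-snd : pair ∘ snd ≐ y
      pair-snd = h₂

      pair-unique : (k : X ⟶ E) → k ∘ fst ≐ x → k ∘ snd ≐ y → k ≐ pair
      pair-unique k p q = ≤⇒≐ k pair (⊓-greatest
        (shiftʳ p₁-map (reflexive p)) (shiftʳ p₂-map (reflexive q)))

    -- Transposing `tab` along p₁ gives `p₂ ≤ p₁ ⨾ i`, and maps are discrete. For i the identity,
    -- the two legs coincide.
    coreflexive : (i : A ⟶ B) → R ≤ proj₁ i → fst ∘ i ≐ snd
    coreflexive i R≤i = ≈.sym (≤⇒≐ snd (fst ∘ i)
      (shiftˡ p₁-map (trans (reflexive tab) R≤i)))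

    tab-commute : (f : A ⟶ C) (g : B ⟶ C) → R ≤ proj₁ f ⨾ proj₁ g ° → fst ∘ f ≐ snd ∘ g
    tab-commute f g p = ≤⇒commute fst snd f g (trans (reflexive tab) p)

  -- The last hypothesis holds when u and v tabulate the kernel e ⨾ e ° of e.
  cover⇒coequalizer : (e : A ⟶ B) (u v : X ⟶ A) → id ≤ proj₁ e ° ⨾ proj₁ e →
                      u ∘ e ≐ v ∘ e → proj₁ e ⨾ proj₁ e ° ≤ proj₁ u ° ⨾ proj₁ v →
                      IsCoequalizer Maps u v e
  cover⇒coequalizer {A} {B} e⁺@(e , _) u⁺@(u , _) v⁺@(v , _) surjective equality kernel = record
    { equality  = equality
    ; universal = λ {_} {h} p → map (isMap/ h p)
    ; factors   = λ {_} {h} p → factors h p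
    ; unique    = λ {_} {h} {p} {k} q → unique h p k q
    }
    where
    -- Points in one fibre of e are linked by `u ° ⨾ v`, along which h is constant.
    ee°-absorb : ∀ {Y} (h : A ⟶ Y) → u⁺ ∘ h ≐ v⁺ ∘ h → e ⨾ (e ° ⨾ proj₁ h) ≤ proj₁ h
    ee°-absorb (h , _) p = begin
      e ⨾ (e ° ⨾ h)  ≈⟨ assoc ⟨
      (e ⨾ e °) ⨾ h  ≤⟨ ⨾-monoʳ kernel ⟩
      (u ° ⨾ v) ⨾ h  ≈⟨ assoc ⟩
      u ° ⨾ (v ⨾ h)  ≤⟨ unshiftˡ (isMap u⁺) (reflexive (≈.sym p)) ⟩
      h              ∎

    -- The induced map is `e ° ⨾ h`: total because e is surjective and h total, single-valued
    -- because h is constant on the fibres of e.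
    isMap/ : ∀ {Y} (h : A ⟶ Y) → u⁺ ∘ h ≐ v⁺ ∘ h → (e ° ⨾ proj₁ h) ⊣ (e ° ⨾ proj₁ h) °
    isMap/ h⁺@(h , _) p = total (begin
        id                          ≤⟨ surjective ⟩
        e ° ⨾ e                     ≤⟨ ⨾-monoˡ (shiftˡ (isMap h⁺) refl) ⟩
        e ° ⨾ (h ⨾ (h ° ⨾ e))       ≈⟨ assoc ⟨
        (e ° ⨾ h) ⨾ (h ° ⨾ e)       ∎)
      , (begin
        (e ° ⨾ h) ° ⨾ (e ° ⨾ h)     ≈⟨ ⨾-cong °-°-⨾ ≈.refl ⟩
        (h ° ⨾ e) ⨾ (e ° ⨾ h)       ≈⟨ assoc ⟩
        h ° ⨾ (e ⨾ (e ° ⨾ h))       ≤⟨ ⨾-monoˡ (ee°-absorb h⁺ p) ⟩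
        h ° ⨾ h                     ≤⟨ proj₂ (isMap h⁺) ⟩
        id                          ∎)

    factors : ∀ {Y} (h : A ⟶ Y) (p : u⁺ ∘ h ≐ v⁺ ∘ h) → e⁺ ∘ map (isMap/ h p) ≐ h
    factors h p = Homs.antisym (ee°-absorb h p) (shiftˡ (isMap e⁺) refl)

    unique : ∀ {Y} (h : A ⟶ Y) (p : u⁺ ∘ h ≐ v⁺ ∘ h) (k : B ⟶ Y) →
             e⁺ ∘ k ≐ h → k ≐ map (isMap/ h p)
    unique h p k q = ≈.sym (≤⇒≐ (map (isMap/ h p)) k
      (unshiftˡ (isMap e⁺) (reflexive (≈.sym q))))

  mono : {m : A ⟶ B} → proj₁ m ⨾ proj₁ m ° ≤ id → Mono Maps m
  mono {m = m} injective {u = u} {v} p = ≤⇒≐ u v (begin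
    proj₁ u                            ≤⟨ shiftʳ (isMap m) (reflexive p) ⟩
    (proj₁ v ⨾ proj₁ m) ⨾ proj₁ m °    ≈⟨ assoc ⟩
    proj₁ v ⨾ (proj₁ m ⨾ proj₁ m °)    ≤⟨ ⨾-monoˡ injective ⟩
    proj₁ v ⨾ id                       ≈⟨ identityʳ ⟩
    proj₁ v                            ∎)

  -- Finite limits, image factorizations and regularity for maps.

  module _ (𝒰 : UnitaryTabular 𝒞 𝒜) where
    open UnitaryTabular 𝒰

    terminal : Terminal Maps
    terminal = record
      { ⊤        = unit
      ; !        = λ {A} → ! A
      ; !-unique = λ {A} {f} {g} → ≈.trans (≤⇒≐ f (! A) top-max) (≈.sym (≤⇒≐ g (! A) top-max))
      }
      where
      ! : ∀ A → A ⟶ unit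
      ! A = top , top , unit-total , trans top-max top-unit

    product : ∀ A B → Product Maps A B
    product A B = record
      { π₁       = fst
      ; π₂       = snd
      ; ⟨_,_⟩    = λ f g → pair f g top-max
      ; project₁ = λ {_} {f} {g} → pair-fst f g top-max
      ; project₂ = λ {_} {f} {g} → pair-snd f g top-max
      ; unique   = λ {_} {f} {g} {h} p q → pair-unique f g top-max h p q
      }
      where open TabulationProperties (tabulate (top {A} {B}))

    idₘ : A ⟶ A
    idₘ = Category.id Maps

    equalizer : (f g : A ⟶ B) → Equalizer Maps f g
    equalizer {A} f g = record
      { eq        = fst
      ; equality  = ≈.trans (tab-commute f g ⊓-lower₂) (⨾-cong (≈.sym fst≐snd) ≈.refl)
      ; universal = λ {_} {h} p → pair h h (bound h p)
      ; factors   = λ {_} {h} p → pair-fst h h (bound h p)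
      ; unique    = λ {_} {h} {p} {k} q →
          pair-unique h h (bound h p) k q (≈.trans (⨾-cong ≈.refl (≈.sym fst≐snd)) q)
      }
      where
      -- The coreflexive of points where f and g agree: lying below `id` makes the legs equal, lying
      -- below `f ⨾ g °` makes them equalize.
      open TabulationProperties (tabulate (id ⊓ (proj₁ f ⨾ proj₁ g °)))
      fst≐snd : fst ≐ snd
      fst≐snd = ≈.trans (≈.sym identityʳ) (coreflexive idₘ ⊓-lower₁)
      bound : (h : X ⟶ A) → h ∘ f ≐ h ∘ g → proj₁ h ° ⨾ proj₁ h ≤ id ⊓ (proj₁ f ⨾ proj₁ g °)
      bound h p = ⊓-greatest (proj₂ (isMap h)) (commute⇒≤ (isMap h) (isMap g) p)

    record CoverMono {A B} (f : A ⟶ B) : Set (o ⊔ c ⊔ ℓ₁ ⊔ ℓ₂) where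
      field
        {I}        : Obj
        e          : A ⟶ I
        m          : I ⟶ B
        factors    : e ∘ m ≐ f
        surjective : id ≤ proj₁ e ° ⨾ proj₁ e
        injective  : proj₁ m ⨾ proj₁ m ° ≤ id

      coequalizes : (u v : X ⟶ A) → u ∘ f ≐ v ∘ f → u ∘ e ≐ v ∘ e
      coequalizes u v p = mono {m = m} injective {u = u ∘ e} {v ∘ e} (begin-equality
        (proj₁ u ⨾ proj₁ e) ⨾ proj₁ m    ≈⟨ assoc ⟩
        proj₁ u ⨾ (proj₁ e ⨾ proj₁ m)    ≈⟨ ⨾-cong ≈.refl factors ⟩
        proj₁ u ⨾ proj₁ f                ≈⟨ p ⟩
        proj₁ v ⨾ proj₁ f                ≈⟨ ⨾-cong ≈.refl factors ⟨
        proj₁ v ⨾ (proj₁ e ⨾ proj₁ m)    ≈⟨ assoc ⟨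
        (proj₁ v ⨾ proj₁ e) ⨾ proj₁ m    ∎)

    -- The image is the tabulation of `f ° ⨾ f`, the coreflexive of values of f. Its legs coincide,
    -- so `jointly` says that p₁ is injective.
    coverMono : (f : A ⟶ B) → CoverMono f
    coverMono f⁺@(f , _) = record
      { e          = pair f⁺ f⁺ refl
      ; m          = fst
      ; factors    = h₁
      -- `p₁≤` inserts `h ° ⨾ h` in front of p₁, and injectivity of p₁ cancels the remainder.
      ; surjective = begin
          id                          ≤⟨ proj₁ p₁-map ⟩
          p₁ ⨾ p₁ °                   ≤⟨ ⨾-monoʳ p₁≤ ⟩
          ((h ° ⨾ h) ⨾ p₁) ⨾ p₁ °     ≈⟨ assoc ⟩
          (h ° ⨾ h) ⨾ (p₁ ⨾ p₁ °)     ≤⟨ ⨾-monoˡ injective ⟩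
          (h ° ⨾ h) ⨾ id              ≈⟨ identityʳ ⟩
          h ° ⨾ h                     ∎
      ; injective  = injective
      }
      where
      open TabulationProperties (tabulate (f ° ⨾ f))
      h = proj₁ (pair f⁺ f⁺ refl)
      h₁ : h ⨾ p₁ ≈ f
      h₁ = pair-fst f⁺ f⁺ refl
      p₁≈p₂ : p₁ ≈ p₂
      p₁≈p₂ = ≈.trans (≈.sym identityʳ) (coreflexive idₘ (proj₂ (isMap f⁺)))
      injective : p₁ ⨾ p₁ ° ≤ id
      injective = trans (⊓-greatest refl
        (⨾-mono (reflexive p₁≈p₂) (°-mono (reflexive p₁≈p₂)))) jointly
      p₁f°≤h° : p₁ ⨾ f ° ≤ h °
      p₁f°≤h° = begin
        p₁ ⨾ f °              ≤⟨ ⨾-monoˡ (°-mono (reflexive (≈.sym h₁))) ⟩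
        p₁ ⨾ (h ⨾ p₁) °       ≈⟨ ⨾-cong ≈.refl °-⨾ ⟩
        p₁ ⨾ (p₁ ° ⨾ h °)     ≈⟨ assoc ⟨
        (p₁ ⨾ p₁ °) ⨾ h °     ≤⟨ ⨾-monoʳ injective ⟩
        id ⨾ h °              ≈⟨ identityˡ ⟩
        h °                   ∎
      p₁≤ : p₁ ≤ (h ° ⨾ h) ⨾ p₁
      p₁≤ = begin
        p₁                    ≈⟨ p₁≈p₂ ⟩
        p₂                    ≤⟨ shiftˡ p₁-map (reflexive tab) ⟩
        p₁ ⨾ (f ° ⨾ f)        ≈⟨ assoc ⟨
        (p₁ ⨾ f °) ⨾ f        ≤⟨ ⨾-mono p₁f°≤h° (reflexive (≈.sym h₁)) ⟩
        h ° ⨾ (h ⨾ p₁)        ≈⟨ assoc ⟨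
        (h ° ⨾ h) ⨾ p₁        ∎

    -- The legs of the tabulation of `f ⨾ g °` form a cone, hence factor through the given pullback
    -- by a map k, and `k ° ⨾ k ≤ id` removes k.
    pullback-tabulates : {f : A ⟶ C} {g : B ⟶ C} {p : X ⟶ A} {q : X ⟶ B} →
                         IsPullback Maps f g p q → proj₁ f ⨾ proj₁ g ° ≤ proj₁ p ° ⨾ proj₁ q
    pullback-tabulates {f = f} {g} {p⁺@(p , _)} {q⁺@(q , _)} pb = begin
      proj₁ f ⨾ proj₁ g °      ≈⟨ tab ⟨
      p₁ ° ⨾ p₂                ≤⟨ ⨾-mono (°-mono (reflexive (≈.sym (factors₁ s))))
                                         (reflexive (≈.sym (factors₂ s))) ⟩
      (k ⨾ p) ° ⨾ (k ⨾ q)      ≈⟨ ⨾-cong °-⨾ ≈.refl ⟩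
      (p ° ⨾ k °) ⨾ (k ⨾ q)    ≈⟨ assoc ⟩
      p ° ⨾ (k ° ⨾ (k ⨾ q))    ≤⟨ ⨾-monoˡ (unshiftˡ (isMap k⁺) refl) ⟩
      p ° ⨾ q                  ∎
      where
      open IsPullback pb
      open TabulationProperties (tabulate (proj₁ f ⨾ proj₁ g °))
      s : fst ∘ f ≐ snd ∘ g
      s = tab-commute f g refl
      k⁺ = universal {x = fst} {snd} s
      k = proj₁ k⁺

    -- The coequalizer is the cover part e of f. It coequalizes p and q because m is mono, and its
    -- kernel lies below `f ⨾ f °`, hence below `p ° ⨾ q`.
    kernelCoequalizer : {f : A ⟶ B} {p q : X ⟶ A} → IsPullback Maps f f p q → Coequalizer Maps p q
    kernelCoequalizer {f = f⁺@(f , _)} {p} {q} pb = record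
      { coeq = e
      ; isCoequalizer = cover⇒coequalizer e p q surjective
          (coequalizes p q (IsPullback.commute pb))
          (begin
            proj₁ e ⨾ proj₁ e °              ≤⟨ kernel≤ ⟩
            f ⨾ f °                          ≤⟨ pullback-tabulates pb ⟩
            proj₁ p ° ⨾ proj₁ q              ∎)
      }
      where
      open CoverMono (coverMono f⁺)
      kernel≤ : proj₁ e ⨾ proj₁ e ° ≤ f ⨾ f °
      kernel≤ = begin
        proj₁ e ⨾ proj₁ e °                  ≤⟨ ⨾-monoʳ (shiftʳ (isMap m) (reflexive factors)) ⟩
        (f ⨾ proj₁ m °) ⨾ proj₁ e °          ≈⟨ assoc ⟩
        f ⨾ (proj₁ m ° ⨾ proj₁ e °)          ≈⟨ ⨾-cong ≈.refl °-⨾ ⟨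
        f ⨾ (proj₁ e ⨾ proj₁ m) °            ≤⟨ ⨾-monoˡ (°-mono (reflexive factors)) ⟩
        f ⨾ f °                              ∎

    cover⇒regularEpi : (e : A ⟶ B) → id ≤ proj₁ e ° ⨾ proj₁ e → RegularEpi Maps e
    cover⇒regularEpi e surjective = record
      { f = fst
      ; g = snd
      ; isCoequalizer = cover⇒coequalizer e fst snd surjective
          (tab-commute e e refl) (reflexive (≈.sym tab))
      }
      where open TabulationProperties (tabulate (proj₁ e ⨾ proj₁ e °))

    -- The mono part m of r is a split epimorphism, hence m ° ⨾ m = id.
    regularEpi⇒cover : {r : A ⟶ B} → RegularEpi Maps r → id ≤ proj₁ r ° ⨾ proj₁ r
    regularEpi⇒cover {r = r⁺@(r , _)} re = begin
      id                                  ≤⟨ cototal (reflexive (≈.sym km≈id)) ⟩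
      proj₁ m ° ⨾ proj₁ m                 ≈⟨ ⨾-cong ≈.refl identityˡ ⟨
      proj₁ m ° ⨾ (id ⨾ proj₁ m)          ≤⟨ ⨾-monoˡ (⨾-monoʳ surjective) ⟩
      proj₁ m ° ⨾ ((proj₁ e ° ⨾ proj₁ e) ⨾ proj₁ m)   ≈⟨ ⨾-cong ≈.refl assoc ⟩
      proj₁ m ° ⨾ (proj₁ e ° ⨾ (proj₁ e ⨾ proj₁ m))   ≈⟨ assoc ⟨
      (proj₁ m ° ⨾ proj₁ e °) ⨾ (proj₁ e ⨾ proj₁ m)   ≈⟨ ⨾-cong °-⨾ ≈.refl ⟨
      (proj₁ e ⨾ proj₁ m) ° ⨾ (proj₁ e ⨾ proj₁ m)
        ≤⟨ ⨾-mono (°-mono (reflexive factors)) (reflexive factors) ⟩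
      r ° ⨾ r                             ∎
      where
      open CoverMono (coverMono r⁺)
      open RegularEpi re using (f; g; isCoequalizer)
      module Q = IsCoequalizer isCoequalizer
      fe≐ge = coequalizes f g Q.equality
      k = Q.universal {h = e} fe≐ge
      km≈id : proj₁ k ⨾ proj₁ m ≈ id
      km≈id = ≈.trans
        (Q.unique {h = r⁺} {p = Q.equality} {k = k ∘ m} (begin-equality
          r ⨾ (proj₁ k ⨾ proj₁ m)        ≈⟨ assoc ⟨
          (r ⨾ proj₁ k) ⨾ proj₁ m        ≈⟨ ⨾-cong (Q.factors {h = e} fe≐ge) ≈.refl ⟩
          proj₁ e ⨾ proj₁ m              ≈⟨ factors ⟩
          r                              ∎))
        (≈.sym (Q.unique {h = r⁺} {p = Q.equality} {k = idₘ} identityʳ))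

    -- Inserting `id ≤ g ° ⨾ g` into `id ≤ f ⨾ f °` exposes `f ⨾ g °`, which is below `p ° ⨾ q`. So
    -- a composite starting with `p °` is above `id`, and `total` makes p surjective.
    stable : {f : A ⟶ C} {g : B ⟶ C} {p : X ⟶ A} {q : X ⟶ B} →
             IsPullback Maps f g p q → RegularEpi Maps g → RegularEpi Maps p
    stable {f = f⁺@(f , _)} {g⁺@(g , _)} {p⁺@(p , _)} {q⁺@(q , _)} pb r = cover⇒regularEpi p⁺ (begin
      id                                  ≤⟨ total id≤ ⟩
      p ° ⨾ p ° °                         ≈⟨ ⨾-cong ≈.refl °-involutive ⟩
      p ° ⨾ p                             ∎)
      where
      id≤ : id ≤ p ° ⨾ (q ⨾ (g ⨾ f °))
      id≤ = begin
        id                        ≤⟨ proj₁ (isMap f⁺) ⟩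
        f ⨾ f °                   ≈⟨ ⨾-cong identityʳ ≈.refl ⟨
        (f ⨾ id) ⨾ f °            ≤⟨ ⨾-monoʳ (⨾-monoˡ (regularEpi⇒cover r)) ⟩
        (f ⨾ (g ° ⨾ g)) ⨾ f °     ≈⟨ ⨾-cong assoc ≈.refl ⟨
        ((f ⨾ g °) ⨾ g) ⨾ f °     ≈⟨ assoc ⟩
        (f ⨾ g °) ⨾ (g ⨾ f °)     ≤⟨ ⨾-monoʳ (pullback-tabulates pb) ⟩
        (p ° ⨾ q) ⨾ (g ⨾ f °)     ≈⟨ assoc ⟩
        p ° ⨾ (q ⨾ (g ⨾ f °))     ∎

    maps-isRegular : IsRegular Maps
    maps-isRegular = record
      { finiteLimits = record
        { terminal = terminal ; product = product ; equalizer = equalizer }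
      ; kernelCoequalizer = kernelCoequalizer
      ; stable            = stable
      }

-- The allegory of internal relations, argued on generalized elements.

module InternalAllegory {o ℓ e c ℓ₁ ℓ₂} (ℛ : RegularCategory o ℓ e)
  (P : AjaxPoFunctor (Relations.Rel ℛ) (POSET c ℓ₁ ℓ₂)) where
  open RegularCategory ℛ
  open RegularTools ℛ renaming (! to bang)
  open Relations ℛ using (swap)
  open InternalRelations ℛ P
  open Logic

  private variable
    Γ Γ₁ Γ₂ Γ₃ Δ : Obj

  infix 11 _°
  _° : Pred (Γ₁ × Γ₂) → Pred (Γ₂ × Γ₁)
  θ ° = (swap *) θ

  °-intro : {ψ : Pred Δ} {θ : Pred (Γ₁ × Γ₂)} {x : Δ ⇒ Γ₁} {y : Δ ⇒ Γ₂} →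
            ψ ⊢ θ [ ⟨ x , y ⟩ ] → ψ ⊢ θ ° [ ⟨ y , x ⟩ ]
  °-intro p = at-⨾⁻¹ (at-cong (Equiv.sym (Equiv.trans ⨾⟨⟩ (⟨⟩-cong project₂ project₁))) p)

  °-elim : {ψ : Pred Δ} {θ : Pred (Γ₁ × Γ₂)} {x : Δ ⇒ Γ₁} {y : Δ ⇒ Γ₂} →
           ψ ⊢ θ ° [ ⟨ y , x ⟩ ] → ψ ⊢ θ [ ⟨ x , y ⟩ ]
  °-elim p = at-cong (Equiv.trans ⨾⟨⟩ (⟨⟩-cong project₂ project₁)) (at-⨾ p)

  ⊓-intro : {ψ : Pred Δ} {θ χ : Pred Γ} {x : Δ ⇒ Γ} →
            ψ ⊢ θ [ x ] → ψ ⊢ χ [ x ] → ψ ⊢ θ ⊓ χ [ x ]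
  ⊓-intro p q = at-⨾⁻¹ (at-cong (Equiv.sym ⨾δ) (⊠-intro p q))

  ⊓-elim₁ : {ψ : Pred Δ} {θ χ : Pred Γ} {x : Δ ⇒ Γ} → ψ ⊢ θ ⊓ χ [ x ] → ψ ⊢ θ [ x ]
  ⊓-elim₁ = at-mono ⊓-lower₁

  ⊓-elim₂ : {ψ : Pred Δ} {θ χ : Pred Γ} {x : Δ ⇒ Γ} → ψ ⊢ θ ⊓ χ [ x ] → ψ ⊢ χ [ x ]
  ⊓-elim₂ = at-mono ⊓-lower₂

  graphᵢ : Γ ⇒ Γ₁ → Pred Γ → Pred (Γ × Γ₁)
  graphᵢ f φ = (⟨ id , f ⟩ !) φ

  graphᵢ-intro : {ψ : Pred Δ} {φ : Pred Γ} {f : Γ ⇒ Γ₁} {x : Δ ⇒ Γ} {y : Δ ⇒ Γ₁} →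
                 x ⨾ f ≈ y → ψ ⊢ φ [ x ] → ψ ⊢ graphᵢ f φ [ ⟨ x , y ⟩ ]
  graphᵢ-intro p q = at-cong (Equiv.trans ⨾⟨⟩ (⟨⟩-cong identityʳ p)) (!-intro q)

  -- A direct image has a witness only over a further context E, so the continuation receives the
  -- equation of terms after reindexing along p.
  graphᵢ-elim : {ψ χ : Pred Δ} {φ : Pred Γ} {f : Γ ⇒ Γ₁} {x : Δ ⇒ Γ} {y : Δ ⇒ Γ₁} →
                ψ ⊢ graphᵢ f φ [ ⟨ x , y ⟩ ] →
                (∀ {E} {p : E ⇒ Δ} {ω : Pred E} → (p ⨾ x) ⨾ f ≈ p ⨾ y → ω ⊢ ψ [ p ] →
                   ω ⊢ φ [ p ⨾ x ] → ω ⊢ χ [ p ]) →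
                ψ ⊢ χ
  graphᵢ-elim h k = !-elim h λ s a b →
    let u = Equiv.trans (Equiv.sym identityʳ) (Equiv.trans (⨾-congˡ (Equiv.sym project₁))
              (Equiv.trans (pullˡ s) (pullʳ project₁)))
        v = Equiv.trans (⨾-congˡ (Equiv.sym project₂)) (Equiv.trans (pullˡ s) (pullʳ project₂))
    in k (Equiv.trans (⨾-congʳ (Equiv.sym u)) v) a (at-cong u b)

  ⨟ᵢ-° : {θ : Pred (Γ₁ × Γ₂)} {χ : Pred (Γ₂ × Γ₃)} → (θ ⨟ᵢ χ) ° ≃ χ ° ⨟ᵢ θ °
  ⨟ᵢ-° = ⊢-antisym
    (⊢-ext λ h → ⨟ᵢ-elim (°-elim h) λ _ r s → at-pair (⨟ᵢ-intro (°-intro s) (°-intro r)))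
    (⊢-ext λ h → °-intro (⨟ᵢ-elim h λ _ s r → at-pair (⨟ᵢ-intro (°-elim r) (°-elim s))))

  -- If y is the middle witness for `θ ⨟ᵢ χ` at (x, z), then x is a middle witness for `θ ° ⨟ᵢ ξ` at
  -- (y, z).
  ⨟ᵢ-modular : {θ : Pred (Γ₁ × Γ₂)} {χ : Pred (Γ₂ × Γ₃)} {ξ : Pred (Γ₁ × Γ₃)} →
               (θ ⨟ᵢ χ) ⊓ ξ ⊢ θ ⨟ᵢ (χ ⊓ (θ ° ⨟ᵢ ξ))
  ⨟ᵢ-modular = ⊢-ext λ h → ⨟ᵢ-elim (⊓-elim₁ h) λ a r s → at-pair
    (⨟ᵢ-intro r (⊓-intro s (⨟ᵢ-intro (°-intro r) (reindex₂ a (⊓-elim₂ h)))))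

  intRelAllegory : Allegory IntRel
  intRelAllegory = record
    { _°           = λ (θ , s) → θ ° , supported λ h →
                       support₂ s (°-elim h) , support₁ s (°-elim h)
    ; °-mono       = *-mono
    ; °-involutive = ⊢-antisym (⊢-ext λ h → °-elim (°-elim h)) (⊢-ext λ h → °-intro (°-intro h))
    ; °-⨾          = ⨟ᵢ-°
    ; _⊓_          = λ (θ , s) (χ , _) → θ ⊓ χ , supported λ h →
                       support₁ s (⊓-elim₁ h) , support₂ s (⊓-elim₁ h)
    ; ⊓-lower₁     = ⊓-lower₁
    ; ⊓-lower₂     = ⊓-lower₂
    ; ⊓-greatest   = ⊓-greatest
    ; modular      = ⨟ᵢ-modular
    }

  private
    module 𝒜 = Allegory intRelAllegory
    module 𝕀 = PoCategory IntRel

  -- Tabulations by comprehension, and the unit.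

  tabulation : {A B : 𝕀.Obj} (R : A 𝕀.⇒ B) → 𝒜.Tabulation R
  tabulation {Γ₁ , φ₁} {Γ₂ , φ₂} (θ , s) = record
    { ∣R∣     = Γ₁ × Γ₂ , θ
    ; p₁      = leg π₁ , leg-supported (!⇒* (proj₁ s))
    ; p₂      = leg π₂ , leg-supported (!⇒* (proj₂ s))
    ; p₁-map  = leg-total , leg-univalent (!⇒* (proj₁ s))
    ; p₂-map  = leg-total , leg-univalent (!⇒* (proj₂ s))
    ; tab     = ⊢-antisym
        (⊢-ext λ h → ⨟ᵢ-elim h λ _ r t → at-pair (legs-hold (°-elim r) t))
        (⊢-ext λ h → ⨟ᵢ-intro (°-intro (graphᵢ-intro project₁ h)) (graphᵢ-intro project₂ h))
    -- Two points related by both kernels share a value under π₁ and, over a further context, a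
    -- value under π₂; `reindex₂ b` carries the first pair of facts there.
    ; jointly = ⊢-ext λ h → ⨟ᵢ-elim (⊓-elim₁ h) λ a r t → at-pair
        (⨟ᵢ-elim (reindex₂ a (⊓-elim₂ h)) λ b r′ t′ → at-pair
          (legs-monic (reindex₂ b r) (°-elim (reindex₂ b t)) r′ (°-elim t′)))
    }
    where
    leg : (f : Γ₁ × Γ₂ ⇒ Γ) → Pred ((Γ₁ × Γ₂) × Γ)
    leg f = graphᵢ f θ

    leg-supported : {f : Γ₁ × Γ₂ ⇒ Γ} {φ : Pred Γ} → θ ⊢ φ [ f ] → Supported θ φ (leg f)
    leg-supported t = supported λ h →
        graphᵢ-elim h (λ _ _ b → at-⨾⁻¹ b)
      , graphᵢ-elim h (λ u _ b → at-⨾⁻¹ (at-cong u (reindex b t)))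

    leg-total : {f : Γ₁ × Γ₂ ⇒ Γ} → idᵢ θ ⊢ leg f ⨟ᵢ leg f °
    leg-total = ⊢-ext λ h → idᵢ-elim h λ u _ b → at-pair (⨟ᵢ-intro
      (graphᵢ-intro Equiv.refl b) (°-intro (graphᵢ-intro (⨾-congʳ (Equiv.sym u)) (at-cong u b))))

    leg-univalent : {f : Γ₁ × Γ₂ ⇒ Γ} {φ : Pred Γ} → θ ⊢ φ [ f ] → leg f ° ⨟ᵢ leg f ⊢ idᵢ φ
    leg-univalent t = ⊢-ext λ h → ⨟ᵢ-elim h λ _ r q → at-pair
      (graphᵢ-elim (°-elim r) λ u a b → at-pair (graphᵢ-elim (reindex₂ a q) λ v a′ b′ → at-pair
        (idᵢ-intro (Equiv.trans (⨾-congˡ (Equiv.sym u)) (Equiv.trans sym-assoc v))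
          (at-cong (pullʳ u) (reindex b′ t)))))

    legs-hold : {ψ : Pred Δ} {w : Δ ⇒ Γ₁ × Γ₂} {x : Δ ⇒ Γ₁} {y : Δ ⇒ Γ₂} →
                ψ ⊢ leg π₁ [ ⟨ w , x ⟩ ] → ψ ⊢ leg π₂ [ ⟨ w , y ⟩ ] → ψ ⊢ θ [ ⟨ x , y ⟩ ]
    legs-hold r t = graphᵢ-elim r λ u a b → at-pair (graphᵢ-elim (reindex₂ a t) λ v a′ b′ →
      at-pair (at-cong (ext (Equiv.trans (pullʳ u) (Equiv.sym project₁))
                            (Equiv.trans v (Equiv.sym project₂))) b′))

    -- Nested eliminations place both graph equations over one context, where the common value x
    -- cancels. The result is an equation of terms over E, hence the continuation.
    same-image : {f : Γ₁ × Γ₂ ⇒ Γ} {ψ χ : Pred Δ} {w w′ : Δ ⇒ Γ₁ × Γ₂} {x : Δ ⇒ Γ} →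
                 ψ ⊢ leg f [ ⟨ w , x ⟩ ] → ψ ⊢ leg f [ ⟨ w′ , x ⟩ ] →
                 (∀ {E} {p : E ⇒ Δ} {ω : Pred E} → (p ⨾ w) ⨾ f ≈ (p ⨾ w′) ⨾ f →
                    ω ⊢ ψ [ p ] → ω ⊢ θ [ p ⨾ w ] → ω ⊢ χ [ p ]) →
                 ψ ⊢ χ
    same-image r t k = graphᵢ-elim r λ u a b → graphᵢ-elim (reindex₂ a t) λ v a′ b′ →
      at-⨾⁻¹ (k (Equiv.trans (⨾-congʳ assoc) (Equiv.trans (pullʳ u)
                  (Equiv.trans (Equiv.sym v) (⨾-congʳ sym-assoc))))
                (reindex a′ a) (at-cong sym-assoc (reindex a′ b)))

    legs-monic : {ψ : Pred Δ} {w w′ : Δ ⇒ Γ₁ × Γ₂} {x : Δ ⇒ Γ₁} {y : Δ ⇒ Γ₂} →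
                 ψ ⊢ leg π₁ [ ⟨ w , x ⟩ ] → ψ ⊢ leg π₁ [ ⟨ w′ , x ⟩ ] →
                 ψ ⊢ leg π₂ [ ⟨ w , y ⟩ ] → ψ ⊢ leg π₂ [ ⟨ w′ , y ⟩ ] →
                 ψ ⊢ idᵢ θ [ ⟨ w , w′ ⟩ ]
    legs-monic r t r′ t′ = same-image r t λ u a _ → at-pair
      (same-image (reindex₂ a r′) (reindex₂ a t′) λ v _ b → at-pair
        (idᵢ-intro (ext (Equiv.trans (pullʳ u) sym-assoc) v) b))

  intRelUnitaryTabular : UnitaryTabular IntRel intRelAllegory
  intRelUnitaryTabular = record
    { top        = λ { {_ , φ₁} {_ , φ₂} → φ₁ ⊠ φ₂ , supported λ h →
                     at-cong project₁ (⊠-elim₁ h) , at-cong project₂ (⊠-elim₂ h) }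
    ; top-max    = λ { {R = _ , s} → ⊢-ext λ h → ⊠-intro (support₁ s h) (support₂ s h) }
    -- All terms into `⊤` are equal, which gives `top-unit`; `true` holds at `bang`, the middle
    -- witness for `unit-total`.
    ; unit       = ⊤ , true
    ; top-unit   = ⊢-ext λ h → idᵢ-intro !-unique (at-cong project₁ (⊠-elim₁ h))
    ; unit-total = ⊢-ext λ h → idᵢ-elim h λ u _ b → at-pair (⨟ᵢ-intro
                     (⊠-intro b truth) (⊠-intro truth (at-cong u b)))
    ; tabulate   = tabulation
    }
    where
    truth : {ψ : Pred Δ} → ψ ⊢ true [ bang ]
    truth = ⊢-trans true-max (⊢-trans (*-cong !-unique) (≃⇒⊢ *-⨾))

theorem54 : ∀ {t c ℓ₁ ℓ₂} (𝒫 : RegularCalculus t c ℓ₁ ℓ₂) → IsRegular (InternalFunctions 𝒫)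
theorem54 𝒫 = MapsOf.maps-isRegular {𝒞 = 𝕀ntRel 𝒫} allegory unitaryTabular
  where
  open RegularCalculus 𝒫
  allegory : Allegory (𝕀ntRel 𝒫)
  allegory = InternalAllegory.intRelAllegory (FRg T) P
  unitaryTabular : UnitaryTabular (𝕀ntRel 𝒫) allegory
  unitaryTabular = InternalAllegory.intRelUnitaryTabular (FRg T) P
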